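{- There exists an integer $n_0$ such that for every integer $n\ge n_0$, $$\mathrm{ex}(n,K_3,2C_5)=\left\lfloor\frac{(n-1)^2}{4}\right\rfloor,$$ and $K_1+T_2(n-1)$ is the unique extremal graph; that is, up to isomorphism, $K_1+T_2(n-1)$ is the only $2C_5$-free graph on $n$ vertices containing exactly $\mathrm{ex}(n,K_3,2C_5)$ triangles.
   Context: All graphs are finite and simple. $K_m$ and $C_m$ denote the complete graph and the cycle on $m$ vertices. For a graph $F$, $kF$ denotes the disjoint union of $k$ copies of $F$ (so $2C_5$ is two vertex-disjoint 5-cycles). A graph is $F$-free if it contains no subgraph (not necessarily induced) isomorphic to $F$. The generalized Turán number $\mathrm{ex}(n,K_s,F)$ is the maximum number of copies of $K_s$ (complete subgraphs on $s$ vertices) in an $F$-free graph on $n$ vertices. The join $G+H$ is obtained from the disjoint union of $G$ and $H$ by adding all edges between $V(G)$ and $V(H)$. The Turán graph $T_r(n)$ is the complete $r$-partite graph on $n$ vertices whose part sizes differ pairwise by at most one. -}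

module Defs where

open import Data.Fin.Base using (Fin; toℕ; splitAt; remQuot)
open import Data.Fin.Properties using (_≟_; all?; nonZeroIndex; toℕ-injective; toℕ-fromℕ<; toℕ<n)
open import Data.Fin.Subset using (Subset; inside; outside; _∈_; ∣_∣)
open import Data.Fin.Subset.Properties using (_∈?_)
open import Data.List.Base as List using (List; _++_)
open import Data.Nat.Base
open import Data.Nat.DivMod using (_%_; _/_; _mod_; m%n<n; m<n⇒m%n≡m; [m+kn]%n≡m%n; m≡m%n+[m/n]*n)
import Data.Nat.Properties as ℕ
open import Data.Product.Base using (∃; _×_; _,_; proj₁; proj₂)
open import Data.Sum.Base using (_⊎_; inj₁; inj₂; swap)
open import Data.Unit.Base using (⊤; tt)
open import Data.Vec.Base using ([]; _∷_; count; tabulate)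
open import Function.Base using (_∘_)
open import Function.Bundles using (_↔_; _⇔_; Inverse)
open import Function.Definitions using (Injective)
open import Level using (0ℓ)
open import Relation.Binary.Core using (Rel)
open import Relation.Binary.Definitions using (Decidable; Symmetric)
open import Relation.Binary.PropositionalEquality
open import Relation.Nullary using (¬_; Dec; yes; no; ¬?; _×-dec_; _⊎-dec_; _→-dec_; contradiction)

private
  variable
    m n r : ℕ

record Graph (n : ℕ) : Set₁ where
  field
    Adj     : Rel (Fin n) 0ℓ
    adj?    : Decidable Adj
    adj-sym : Symmetric Adj
    loopless : ∀ {i} → ¬ Adj i i

open Graph public

infix 4 _⊑_ _≅_

-- The subgraph need not be induced, so preserves goes one way only.

record _⊑_ (F : Graph m) (G : Graph n) : Set where
  field
    embed     : Fin m → Fin n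
    injective : Injective _≡_ _≡_ embed
    preserves : ∀ {i j} → Adj F i j → Adj G (embed i) (embed j)

_-Free : Graph m → Graph n → Set
(F -Free) G = ¬ (F ⊑ G)

-- The numbers of vertices are not required to agree definitionally, so
-- that a graph on n vertices can be compared with one on 1 + (n ∸ 1).

record _≅_ (G : Graph m) (H : Graph n) : Set where
  field
    bijection : Fin m ↔ Fin n
    adj⇔adj   : ∀ i j → Adj G i j ⇔ Adj H (Inverse.to bijection i) (Inverse.to bijection j)

K : ∀ m → Graph m
K m = record
  { Adj      = _≢_
  ; adj?     = λ i j → ¬? (i ≟ j)
  ; adj-sym  = λ i≢j → i≢j ∘ sym
  ; loopless = λ i≢i → i≢i refl
  }

-- The cycle 0, 1, …, m - 1, 0.  The conjunct i ≢ j only matters for m = 1.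

C : ∀ m → Graph m
C m = record
  { Adj      = λ i j → i ≢ j × (Next i j ⊎ Next j i)
  ; adj?     = λ i j → ¬? (i ≟ j) ×-dec (next? i j ⊎-dec next? j i)
  ; adj-sym  = λ (i≢j , e) → i≢j ∘ sym , swap e
  ; loopless = λ (i≢i , _) → i≢i refl
  }
  where
  Next : Rel (Fin m) 0ℓ
  Next i j = toℕ j ≡ (suc (toℕ i) % m) {{nonZeroIndex i}}

  next? : Decidable Next
  next? i j = toℕ j ℕ.≟ (suc (toℕ i) % m) {{nonZeroIndex i}}

-- k ∙ F is the disjoint union of k copies of F : the vertex v of copy c is
-- the one that remQuot sends to (c , v).

infixr 7 _∙_

_∙_ : ∀ k → Graph m → Graph (k * m)
_∙_ {m} k F = record
  { Adj      = λ u v → copy u ≡ copy v × Adj F (vertex u) (vertex v)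
  ; adj?     = λ u v → (copy u ≟ copy v) ×-dec adj? F (vertex u) (vertex v)
  ; adj-sym  = λ (p , e) → sym p , adj-sym F e
  ; loopless = λ (_ , e) → loopless F e
  }
  where
  copy : Fin (k * m) → Fin k
  copy = proj₁ ∘ remQuot m

  vertex : Fin (k * m) → Fin m
  vertex = proj₂ ∘ remQuot {k} m

JoinAdj : Graph m → Graph n → Rel (Fin m ⊎ Fin n) 0ℓ
JoinAdj G H (inj₁ i) (inj₁ j) = Adj G i j
JoinAdj G H (inj₁ _) (inj₂ _) = ⊤
JoinAdj G H (inj₂ _) (inj₁ _) = ⊤
JoinAdj G H (inj₂ i) (inj₂ j) = Adj H i j

infixr 6 _+ᴳ_

_+ᴳ_ : Graph m → Graph n → Graph (m + n)
_+ᴳ_ {m} {n} G H = record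
  { Adj      = λ u v → JoinAdj G H (splitAt m u) (splitAt m v)
  ; adj?     = λ u v → join? (splitAt m u) (splitAt m v)
  ; adj-sym  = λ {u} {v} → join-sym (splitAt m u) (splitAt m v)
  ; loopless = λ {u} → join-loopless (splitAt m u)
  }
  where
  join? : Decidable (JoinAdj G H)
  join? (inj₁ i) (inj₁ j) = adj? G i j
  join? (inj₁ _) (inj₂ _) = yes tt
  join? (inj₂ _) (inj₁ _) = yes tt
  join? (inj₂ i) (inj₂ j) = adj? H i j

  join-sym : ∀ x y → JoinAdj G H x y → JoinAdj G H y x
  join-sym (inj₁ _) (inj₁ _) e = adj-sym G e
  join-sym (inj₁ _) (inj₂ _) _ = tt
  join-sym (inj₂ _) (inj₁ _) _ = tt
  join-sym (inj₂ _) (inj₂ _) e = adj-sym H e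

  join-loopless : ∀ x → ¬ JoinAdj G H x x
  join-loopless (inj₁ _) = loopless G
  join-loopless (inj₂ _) = loopless H

completeMultipartite : (Fin n → Fin r) → Graph n
completeMultipartite part = record
  { Adj      = λ i j → part i ≢ part j
  ; adj?     = λ i j → ¬? (part i ≟ part j)
  ; adj-sym  = λ p≢q → p≢q ∘ sym
  ; loopless = λ p≢p → p≢p refl
  }

-- T r n is the Turán graph T_r(n) : its parts are the residue classes mod r,
-- whose sizes differ by at most one (turán-balanced below).

turánPart : ∀ r n .{{_ : NonZero r}} → Fin n → Fin r
turánPart r n i = toℕ i mod r

T : ∀ r n .{{_ : NonZero r}} → Graph n
T r n = completeMultipartite (turánPart r n)

subsets : ∀ n → List (Subset n)
subsets zero    = List.[ [] ]
subsets (suc n) = List.map (inside ∷_) (subsets n) ++ List.map (outside ∷_) (subsets n)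

-- A copy of K_s in G is determined by its vertex set.

IsClique : Graph n → ℕ → Subset n → Set
IsClique G s p = ∣ p ∣ ≡ s × (∀ i j → i ∈ p → j ∈ p → i ≢ j → Adj G i j)

isClique? : (G : Graph n) → ∀ s p → Dec (IsClique G s p)
isClique? G s p = (∣ p ∣ ℕ.≟ s) ×-dec
  all? λ i → all? λ j → (i ∈? p) →-dec ((j ∈? p) →-dec (¬? (i ≟ j) →-dec adj? G i j))

#K : ℕ → Graph n → ℕ
#K {n} s G = List.length (List.filter (isClique? G s) (subsets n))

-- IsEx n s F e : ex(n, K_s, F) = e.  A relation rather than a function, since
-- the maximum does not exist when every graph on n vertices contains F.

IsEx : ℕ → ℕ → Graph m → ℕ → Set₁
IsEx n s F e =
  (∃ λ (G : Graph n) → (F -Free) G × #K s G ≡ e) ×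
  (∀ (G : Graph n) → (F -Free) G → #K s G ≤ e)

IsExtremal : ℕ → Graph m → Graph n → Set₁
IsExtremal {n = n} s F G = (F -Free) G × IsEx n s F (#K s G)

partSize : (Fin n → Fin r) → Fin r → ℕ
partSize part a = count (_≟ a) (tabulate part)

private
  δ : Fin r → Fin r → ℕ
  δ a b with b ≟ a
  ... | yes _ = 1
  ... | no  _ = 0

  count-snoc : ∀ (g : ℕ → Fin r) a n →
               count (_≟ a) (tabulate {n = suc n} (g ∘ toℕ)) ≡
               δ a (g n) + count (_≟ a) (tabulate {n = n} (g ∘ toℕ))
  count-snoc g a zero with g 0 ≟ a
  ... | yes _ = refl
  ... | no  _ = refl
  count-snoc g a (suc n) with g 0 ≟ a
  ... | no  _ = count-snoc (g ∘ suc) a n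
  ... | yes _ = trans (cong suc (count-snoc (g ∘ suc) a n)) (sym (ℕ.+-suc (δ a (g (suc n))) _))

  module _ (r : ℕ) .{{_ : NonZero r}} (a : Fin r) where

    size : ℕ → ℕ
    size n = partSize (turánPart r n) a

    residue : ∀ q {k} → k < r → toℕ ((k + q * r) mod r) ≡ k
    residue q {k} k<r = trans (toℕ-fromℕ< _) (trans ([m+kn]%n≡m%n k q r) (m<n⇒m%n≡m k<r))

    size-step : ∀ n → size (suc n) ≡ δ a (n mod r) + size n
    size-step = count-snoc (_mod r) a

    Sizes : ℕ → ℕ → Set
    Sizes q k = (toℕ a < k → size (k + q * r) ≡ suc q) × (k ≤ toℕ a → size (k + q * r) ≡ q)

    sizes : ∀ q k → k ≤ r → Sizes q k
    sizes zero    zero _ = (λ ()) , λ _ → refl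
    sizes (suc q) zero _ = (λ ()) , λ _ → proj₁ (sizes q r ℕ.≤-refl) (toℕ<n a)
    sizes q (suc k) k<r with (k + q * r) mod r ≟ a | size-step (k + q * r) | sizes q k (ℕ.<⇒≤ k<r)
    ... | yes k≡a | step | _ , ≥ =
      let k≡ = trans (sym (residue q k<r)) (cong toℕ k≡a) in
      (λ _ → trans step (cong suc (≥ (ℕ.≤-reflexive k≡)))) ,
      λ k<a → contradiction k≡ (ℕ.<⇒≢ k<a)
    ... | no  k≢a | step | < , ≥ =
      (λ a≤k → trans step (< (ℕ.≤∧≢⇒< (s≤s⁻¹ a≤k) λ a≡k →
        k≢a (toℕ-injective (trans (residue q k<r) (sym a≡k)))))) ,
      λ k<a → trans step (≥ (ℕ.<⇒≤ k<a))

    size-bounds : ∀ n → n / r ≤ size n × size n ≤ suc (n / r)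
    size-bounds n with toℕ a ℕ.<? n % r | sizes (n / r) (n % r) (ℕ.<⇒≤ (m%n<n n r))
    ... | yes a<k | < , _ rewrite trans (cong size (m≡m%n+[m/n]*n n r)) (< a<k) = ℕ.n≤1+n _ , ℕ.≤-refl
    ... | no  a≮k | _ , ≥ rewrite trans (cong size (m≡m%n+[m/n]*n n r)) (≥ (ℕ.≮⇒≥ a≮k)) = ℕ.≤-refl , ℕ.n≤1+n _

turán-balanced : ∀ r n .{{_ : NonZero r}} (a b : Fin r) →
                 partSize (turánPart r n) a ≤ suc (partSize (turánPart r n) b)
turán-balanced r n a b =
  ℕ.≤-trans (proj₂ (size-bounds r a n)) (s≤s (proj₁ (size-bounds r b n)))

{-# OPTIONS --safe #-}
module Submission where

-- Let G be 2C₅-free on m + 1 vertices.  Deleting a vertex v with more than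
-- linearly many edges in its neighbourhood leaves a C₅-free graph H, since a
-- 5-cycle of H would be disjoint from one through v.  The triangles of G are
-- those of H and one for each edge of H inside N(v), so there are at most
-- e(H) + t(H) of them.  If no such v exists, G itself is C₅-free up to the
-- edges at one 5-cycle, and has too few triangles.
--
-- It remains to bound e + t for a C₅-free graph H on m vertices.  If H has a
-- triangle and m is large, then some vertex lies in at most 9m/20 edges and
-- triangles altogether: otherwise all degrees are linear, and disjointness of
-- neighbourhoods in a C₅-free graph forces too many vertices.  Deleting such
-- vertices one by one gives e + t < m²/4.  If H is triangle-free, Mantel's
-- theorem applies, and its equality case yields K₁ + T₂(m).

open import Defs
open import Data.Bool.Base using (if_then_else_)
open import Data.Empty using (⊥; ⊥-elim)
open import Data.Fin.Base using (Fin; zero; suc; punchIn; punchOut; toℕ; remQuot; combine)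
open import Data.Fin.Patterns using (0F; 1F; 2F; 3F; 4F)
open import Data.Fin.Permutation as Perm using (Permutation′; _⟨$⟩ʳ_; insert; insert-punchIn)
open import Data.Fin.Properties as Fin
  using (_≟_; all?; any?; punchInᵢ≢i; punchIn-injective; punchIn-punchOut; toℕ-injective;
         combine-remQuot; remQuot-combine; combine-injectiveˡ; combine-injectiveʳ)
open import Data.Fin.Subset using (Subset; inside; outside; _∈_; ∣_∣)
open import Data.Fin.Subset.Properties using (_∈?_)
open import Data.List.Base using (List; []; _∷_; _++_; length; filter; map)
open import Data.List.Properties using (length-++; filter-++; filter-≐)
open import Data.Nat using
  (ℕ; zero; suc; _+_; _*_; _∸_; _^_; _/_; _%_; _≤_; _<_; z≤n; s≤s; s≤s⁻¹; z<s; _≤?_; _<?_)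
open import Data.Nat.Divisibility using (divides-refl)
open import Data.Nat.DivMod
  using (+-distrib-/-∣ʳ; m*n/n≡m; m<n⇒m/n≡0; m/n≡0⇒m<n; /-congˡ; m/n*n≤m; m≡m%n+[m/n]*n; m%n<n)
open import Data.Nat.Properties as ℕ hiding (_≟_)
open import Algebra.Properties.Semiring.Sum +-*-semiring
  using (sum; sum-cong-≗; ∑-distrib-+; ∑-comm; sum-remove; sum-permute; *-distribˡ-sum)
open import Data.Nat.Tactic.RingSolver using (solve-∀)
open import Data.Product using (∃; ∃₂; _×_; _,_; proj₁; proj₂)
open import Data.Sum.Base using (_⊎_; inj₁; inj₂)
open import Data.Unit.Base using (tt)
open import Data.Vec.Base as Vec using ([]; _∷_; here; there; lookup)
open import Data.Vec.Relation.Unary.All using ([]; _∷_)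
open import Data.Vec.Relation.Unary.AllPairs.Core using ([]; _∷_)
open import Data.Vec.Relation.Unary.Unique.Propositional.Properties using (lookup-injective)
open import Function.Base using (_∘_)
open import Function.Bundles using (_⇔_; mk⇔; Inverse; Equivalence)
open import Function.Definitions using (Injective)
open import Relation.Binary.PropositionalEquality
open import Relation.Nullary using (¬_; Dec; yes; no; does; ¬?; contradiction; _×-dec_; _→-dec_)
open import Relation.Nullary.Decidable using (decidable-stable)
open import Relation.Unary using () renaming (Decidable to Decidable₁)

-- The bound e + t ≤ m²/4 fails for small m (K₄ has e + t = 10 against 4), so the induction cannot
-- start from it. It starts from the trivial bound on at most 5880 vertices, whose value becomes the
-- error `c₀`; the deletions build up a surplus linear in m, which must outgrow `c₀`, and this makes
-- the threshold enormous.
--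
-- The ratio 9/20 lies between 1/3 and 1/2. It is below 1/2 because m²/4 grows by about m/2 per
-- vertex, so every deletion gains; it is above 1/3 so that the three almost disjoint neighbourhoods
-- of a triangle overfill the vertex set. That they are almost disjoint needs a bootstrap: N(w)
-- spans at most 2 deg w edges, so at first only deg w ≥ 3n/20 is known. This already excludes seven
-- almost disjoint neighbourhoods, hence bounds codegrees of edges and links by constants, and then
-- the degrees rise to nearly 9n/20.
--
-- When no neighbourhood is rich in edges, t ≤ 4e/3 and e + t ≤ n²/4 + O(1) give t ≤ n²/7 + O(1) for
-- C₅-free graphs, which leaves room for the O(n) triangles that meet one 5-cycle.

private
  variable
    m n k r : ℕ
    A A′ P Q R : Set

-- The slack s is explicit so that the last premise is a semiring identity.
linear-≤ : ∀ {a b l r} s → l ≤ r → a + r + s ≡ b + l → a ≤ b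
linear-≤ {a} {b} {l} {r} s l≤r eq = +-cancelʳ-≤ r a b
  (≤-trans (≤-trans (m≤m+n (a + r) s) (≤-reflexive eq)) (+-monoʳ-≤ b l≤r))

-- Indicators and finite sums

𝟙 : Dec P → ℕ
𝟙 P? = if does P? then 1 else 0

𝟙-yes : (P? : Dec P) → P → 𝟙 P? ≡ 1
𝟙-yes (yes _) _ = refl
𝟙-yes (no ¬p) p = contradiction p ¬p

𝟙-no : (P? : Dec P) → ¬ P → 𝟙 P? ≡ 0
𝟙-no (yes p) ¬p = contradiction p ¬p
𝟙-no (no _)  _  = refl

𝟙≤1 : (P? : Dec P) → 𝟙 P? ≤ 1
𝟙≤1 (yes _) = s≤s z≤n
𝟙≤1 (no _)  = z≤n

𝟙-pos : (P? : Dec P) → 0 < 𝟙 P? → P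
𝟙-pos (yes p) _ = p

𝟙-≤ : (P? : Dec P) → (P → 1 ≤ n) → 𝟙 P? ≤ n
𝟙-≤ (yes p) h = h p
𝟙-≤ (no _)  _ = z≤n

𝟙-mono : (P? : Dec P) (Q? : Dec Q) → (P → Q) → 𝟙 P? ≤ 𝟙 Q?
𝟙-mono P? Q? f = 𝟙-≤ P? λ p → ≤-reflexive (sym (𝟙-yes Q? (f p)))

𝟙-cong : (P? : Dec P) (Q? : Dec Q) → (P → Q) → (Q → P) → 𝟙 P? ≡ 𝟙 Q?
𝟙-cong P? Q? f g = ≤-antisym (𝟙-mono P? Q? f) (𝟙-mono Q? P? g)

𝟙-× : (P? : Dec P) (Q? : Dec Q) → 𝟙 (P? ×-dec Q?) ≡ 𝟙 P? * 𝟙 Q?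
𝟙-× (yes _) (yes _) = refl
𝟙-× (yes _) (no _)  = refl
𝟙-× (no _)  _       = refl

𝟙-×₃ : (P? : Dec P) (Q? : Dec Q) (R? : Dec R) →
       𝟙 (P? ×-dec (Q? ×-dec R?)) ≡ 𝟙 P? * (𝟙 Q? * 𝟙 R?)
𝟙-×₃ P? Q? R? = trans (𝟙-× P? (Q? ×-dec R?)) (cong (𝟙 P? *_) (𝟙-× Q? R?))

sum-mono : {f g : Fin n → ℕ} → (∀ i → f i ≤ g i) → sum f ≤ sum g
sum-mono {zero}  _   = z≤n
sum-mono {suc n} f≤g = +-mono-≤ (f≤g zero) (sum-mono (f≤g ∘ suc))

sum-tight : {f g : Fin n → ℕ} → (∀ i → f i ≤ g i) → sum g ≤ sum f → f ≗ g
sum-tight {suc n} {f} {g} f≤g ∑g≤∑f zero = ≤-antisym (f≤g zero)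
  (+-cancelʳ-≤ (sum (g ∘ suc)) _ _
    (≤-trans ∑g≤∑f (+-monoʳ-≤ (f zero) (sum-mono (f≤g ∘ suc)))))
sum-tight {suc n} {f} {g} f≤g ∑g≤∑f (suc i) = sum-tight (f≤g ∘ suc)
  (+-cancelˡ-≤ (g zero) _ _ (≤-trans ∑g≤∑f (+-monoˡ-≤ (sum (f ∘ suc)) (f≤g zero)))) i

sum-const : ∀ n c → sum {n} (λ _ → c) ≡ n * c
sum-const zero    c = refl
sum-const (suc n) c = cong (c +_) (sum-const n c)

sum-bound : {f : Fin n → ℕ} {c : ℕ} → (∀ i → f i ≤ c) → sum f ≤ n * c
sum-bound {n} {c = c} f≤c = ≤-trans (sum-mono f≤c) (≤-reflexive (sum-const n c))

term≤sum : (f : Fin n → ℕ) → ∀ i → f i ≤ sum f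
term≤sum f zero    = m≤m+n _ _
term≤sum f (suc i) = ≤-trans (term≤sum (f ∘ suc) i) (m≤n+m _ (f zero))

sum-pos : (f : Fin n → ℕ) → 0 < sum f → ∃ λ i → 0 < f i
sum-pos {suc n} f 0<∑ with f zero in eq
... | suc _ = zero , subst (0 <_) (sym eq) z<s
... | zero  with i , 0<fi ← sum-pos (f ∘ suc) 0<∑ = suc i , 0<fi

sum-singleton : (v : Fin n) → sum (λ i → 𝟙 (i ≟ v)) ≡ 1
sum-singleton {suc n} zero = cong suc (trans (sum-cong-≗ {n} λ i → 𝟙-no (suc i ≟ zero) λ ())
  (trans (sum-const n 0) (*-zeroʳ n)))
sum-singleton {suc n} (suc v) = trans (cong₂ _+_ (𝟙-no (Fin.zero {n} ≟ suc v) λ ())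
  (sum-cong-≗ λ i → 𝟙-cong (suc i ≟ suc v) (i ≟ v) Fin.suc-injective (cong suc)))
  (sum-singleton v)

count-pair : {P : Fin n → Set} (P? : ∀ i → Dec (P i)) (u v : Fin n) →
             (∀ i → P i → i ≡ u ⊎ i ≡ v) → sum (λ i → 𝟙 (P? i)) ≤ 2
count-pair P? u v P⊆uv = begin
  sum (λ i → 𝟙 (P? i))                              ≤⟨ sum-mono (λ i → 𝟙-≤ (P? i) (one i ∘ P⊆uv i)) ⟩
  sum (λ i → 𝟙 (i ≟ u) + 𝟙 (i ≟ v))                 ≡⟨ ∑-distrib-+ (λ i → 𝟙 (i ≟ u)) (λ i → 𝟙 (i ≟ v)) ⟩
  sum (λ i → 𝟙 (i ≟ u)) + sum (λ i → 𝟙 (i ≟ v))     ≡⟨ cong₂ _+_ (sum-singleton u) (sum-singleton v) ⟩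
  2                                                 ∎
  where
  open ≤-Reasoning
  one : ∀ i → i ≡ u ⊎ i ≡ v → 1 ≤ 𝟙 (i ≟ u) + 𝟙 (i ≟ v)
  one i (inj₁ i≡u) = ≤-trans (≤-reflexive (sym (𝟙-yes (i ≟ u) i≡u))) (m≤m+n _ _)
  one i (inj₂ i≡v) = ≤-trans (≤-reflexive (sym (𝟙-yes (i ≟ v) i≡v))) (m≤n+m _ _)

choose : {P : Fin n → Set} (P? : ∀ i → Dec (P i)) → k ≤ sum (λ i → 𝟙 (P? i)) →
         ∃ λ (v : Fin k → Fin n) → Injective _≡_ _≡_ v × (∀ i → P (v i))
choose {k = zero} P? _ = (λ ()) , (λ { {()} }) , λ ()
choose {zero} {suc k} P? ()
choose {suc n} {suc k} {P} P? k≤∑ with P? zero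
... | no _ with v , v-inj , Pv ← choose (P? ∘ suc) k≤∑ =
  suc ∘ v , v-inj ∘ Fin.suc-injective , Pv
... | yes P0 with v , v-inj , Pv ← choose (P? ∘ suc) (s≤s⁻¹ k≤∑) = w , w-inj , Pw
  where
  w : Fin (suc k) → Fin (suc n)
  w zero    = zero
  w (suc i) = suc (v i)
  w-inj : Injective _≡_ _≡_ w
  w-inj {zero}  {zero}  _  = refl
  w-inj {suc i} {suc j} eq = cong suc (v-inj (Fin.suc-injective eq))
  Pw : ∀ i → P (w i)
  Pw zero    = P0
  Pw (suc i) = Pv i

argmax : (f : Fin (suc n) → ℕ) → ∃ λ i → ∀ j → f j ≤ f i
argmax {zero} f = zero , λ { zero → ≤-refl }
argmax {suc n} f with argmax (f ∘ suc)
... | i , f≤fi with ≤-total (f zero) (f (suc i))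
...   | inj₁ f0≤fi = suc i , λ { zero → f0≤fi ; (suc j) → f≤fi j }
...   | inj₂ fi≤f0 = zero , λ { zero → ≤-refl ; (suc j) → ≤-trans (f≤fi j) fi≤f0 }

-- Double and triple sums, and the removal of an index

sum₂ : (Fin m → Fin n → ℕ) → ℕ
sum₂ f = sum λ i → sum λ j → f i j

sum₂-mono : {f g : Fin m → Fin n → ℕ} → (∀ i j → f i j ≤ g i j) → sum₂ f ≤ sum₂ g
sum₂-mono f≤g = sum-mono λ i → sum-mono (f≤g i)

sum₂-cong : {f g : Fin m → Fin n → ℕ} → (∀ i j → f i j ≡ g i j) → sum₂ f ≡ sum₂ g
sum₂-cong f≡g = sum-cong-≗ λ i → sum-cong-≗ (f≡g i)

sum₂-distrib-+ : (f g : Fin m → Fin n → ℕ) → sum₂ (λ i j → f i j + g i j) ≡ sum₂ f + sum₂ g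
sum₂-distrib-+ f g = trans (sum-cong-≗ λ i → ∑-distrib-+ (f i) (g i))
  (∑-distrib-+ (λ i → sum (f i)) (λ i → sum (g i)))

sum₂-tight : {f g : Fin m → Fin n → ℕ} → (∀ i j → f i j ≤ g i j) → sum₂ g ≤ sum₂ f →
             ∀ i j → f i j ≡ g i j
sum₂-tight f≤g ∑g≤∑f i = sum-tight (f≤g i)
  (≤-reflexive (sym (sum-tight (λ i → sum-mono (f≤g i)) ∑g≤∑f i)))

sum-removeˡ : (f : Fin (suc n) → ℕ) (v : Fin (suc n)) → f v ≡ 0 → sum f ≡ sum (f ∘ punchIn v)
sum-removeˡ f v fv≡0 = trans (sum-remove {i = v} f) (cong (_+ sum (f ∘ punchIn v)) fv≡0)

-- By symmetry row v and column v have the same sum, and they share only the vanishing diagonal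
-- entry.
sum₂-remove : (f : Fin (suc n) → Fin (suc n) → ℕ) (v : Fin (suc n)) →
              (∀ i j → f i j ≡ f j i) → f v v ≡ 0 →
              sum₂ f ≡ 2 * sum (f v) + sum₂ (λ i j → f (punchIn v i) (punchIn v j))
sum₂-remove f v f-sym fvv≡0 = begin
  sum₂ f
    ≡⟨ sum-remove {i = v} (λ i → sum (f i)) ⟩
  sum (f v) + sum (λ i → sum (f (punchIn v i)))
    ≡⟨ cong (sum (f v) +_) (sum-cong-≗ λ i → sum-remove {i = v} (f (punchIn v i))) ⟩
  sum (f v) + sum (λ i → f (punchIn v i) v + sum (λ j → f (punchIn v i) (punchIn v j)))
    ≡⟨ cong (sum (f v) +_) (∑-distrib-+ (λ i → f (punchIn v i) v)
         (λ i → sum (λ j → f (punchIn v i) (punchIn v j)))) ⟩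
  sum (f v) + (sum (λ i → f (punchIn v i) v) + rest)
    ≡⟨ cong (λ s → sum (f v) + (s + rest)) (trans (sum-cong-≗ λ i → f-sym (punchIn v i) v)
         (sym (sum-removeˡ (f v) v fvv≡0))) ⟩
  sum (f v) + (sum (f v) + rest)
    ≡⟨ regroup (sum (f v)) rest ⟩
  2 * sum (f v) + rest ∎
  where
  open ≡-Reasoning
  rest = sum₂ (λ i j → f (punchIn v i) (punchIn v j))
  regroup : ∀ s r → s + (s + r) ≡ 2 * s + r
  regroup = solve-∀

-- A triple with v in two positions contributes 0 by the symmetries, so the triples through v split
-- into three equal families according to the position of v.
sum₃-remove : (f : Fin (suc n) → Fin (suc n) → Fin (suc n) → ℕ) (v : Fin (suc n)) →
              (∀ i j k → f i j k ≡ f j i k) → (∀ i j k → f i j k ≡ f i k j) → (∀ k → f v v k ≡ 0) →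
              sum (λ i → sum₂ (f i)) ≡ 3 * sum₂ (f v) +
              sum (λ i → sum₂ λ j k → f (punchIn v i) (punchIn v j) (punchIn v k))
sum₃-remove {n} f v swap₁₂ swap₂₃ fvv≡0 = begin
  sum (λ i → sum₂ (f i))
    ≡⟨ sum-remove {i = v} (λ i → sum₂ (f i)) ⟩
  s + sum (λ i → sum₂ (f (punchIn v i)))
    ≡⟨ cong (s +_) (sum-cong-≗ λ i → sum₂-remove (f (punchIn v i)) v (swap₂₃ _)
         (trans (swap₁₂ _ v v) (trans (swap₂₃ v _ v) (fvv≡0 _)))) ⟩
  s + sum (λ i → 2 * sum (f (punchIn v i) v) + inner i)
    ≡⟨ cong (s +_) (∑-distrib-+ (λ i → 2 * sum (f (punchIn v i) v)) inner) ⟩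
  s + (sum (λ i → 2 * sum (f (punchIn v i) v)) + sum inner)
    ≡⟨ cong (λ t → s + (t + sum inner)) (sym (*-distribˡ-sum 2 (λ i → sum (f (punchIn v i) v)))) ⟩
  s + (2 * sum (λ i → sum (f (punchIn v i) v)) + sum inner)
    ≡⟨ cong (λ t → s + (2 * t + sum inner)) (trans (sum₂-cong λ i j → swap₁₂ (punchIn v i) v j)
         (sym (sum-removeˡ (λ i → sum (f v i)) v
           (trans (sum-cong-≗ fvv≡0) (trans (sum-const (suc n) 0) (*-zeroʳ n)))))) ⟩
  s + (2 * s + sum inner)
    ≡⟨ regroup s (sum inner) ⟩
  3 * s + sum inner ∎
  where
  open ≡-Reasoning
  s = sum₂ (f v)
  inner : Fin n → ℕ
  inner i = sum₂ λ j k → f (punchIn v i) (punchIn v j) (punchIn v k)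
  regroup : ∀ s r → s + (2 * s + r) ≡ 3 * s + r
  regroup = solve-∀

-- Counting edges and triangles

module Counting (G : Graph n) where

  adj : Fin n → Fin n → ℕ
  adj i j = 𝟙 (adj? G i j)

  degree : Fin n → ℕ
  degree i = sum (adj i)

  -- Counts every edge twice.
  arcs : ℕ
  arcs = sum degree

  codegree : Fin n → Fin n → ℕ
  codegree i j = sum λ k → adj i k * adj j k

  onTriangle : Fin n → Fin n → Fin n → ℕ
  onTriangle i j k = adj i j * (adj i k * adj j k)

  -- Counts every edge inside the neighbourhood of i twice.
  link : Fin n → ℕ
  link i = sum₂ (onTriangle i)

  -- Counts every triangle six times.
  triangles : ℕ
  triangles = sum link

  adj-comm : ∀ i j → adj i j ≡ adj j i
  adj-comm i j = 𝟙-cong (adj? G i j) (adj? G j i) (adj-sym G) (adj-sym G)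

  adj-irrefl : ∀ i → adj i i ≡ 0
  adj-irrefl i = 𝟙-no (adj? G i i) (loopless G)

  onTriangle-swap₁₂ : ∀ i j k → onTriangle i j k ≡ onTriangle j i k
  onTriangle-swap₁₂ i j k = cong₂ _*_ (adj-comm i j) (*-comm (adj i k) (adj j k))

  onTriangle-swap₂₃ : ∀ i j k → onTriangle i j k ≡ onTriangle i k j
  onTriangle-swap₂₃ i j k = trans (cong (λ x → adj i j * (adj i k * x)) (adj-comm j k))
    (rot (adj i j) (adj i k) (adj k j))
    where
    rot : ∀ x y z → x * (y * z) ≡ y * (x * z)
    rot = solve-∀

  triangle? : ∀ i j k → Dec (Adj G i j × Adj G i k × Adj G j k)
  triangle? i j k = adj? G i j ×-dec (adj? G i k ×-dec adj? G j k)

  onTriangle≡𝟙 : ∀ i j k → onTriangle i j k ≡ 𝟙 (triangle? i j k)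
  onTriangle≡𝟙 i j k = sym (𝟙-×₃ (adj? G i j) (adj? G i k) (adj? G j k))

  adj≢ : ∀ {i j} → Adj G i j → i ≢ j
  adj≢ a refl = loopless G a

  link≡∑codegree : ∀ i → link i ≡ sum λ j → adj i j * codegree i j
  link≡∑codegree i = sum-cong-≗ λ j → sym (*-distribˡ-sum (adj i j) (λ k → adj i k * adj j k))

open Counting public

infixl 7 _∖_
infixl 7 _∣ᴳ_

_∖_ : Graph (suc n) → Fin (suc n) → Graph n
G ∖ v = record
  { Adj      = λ i j → Adj G (punchIn v i) (punchIn v j)
  ; adj?     = λ i j → adj? G (punchIn v i) (punchIn v j)
  ; adj-sym  = adj-sym G
  ; loopless = loopless G
  }

-- The vertices outside P are kept, but isolated.
_∣ᴳ_ : (G : Graph n) {P : Fin n → Set} → (∀ i → Dec (P i)) → Graph n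
_∣ᴳ_ G {P} P? = record
  { Adj      = λ i j → Adj G i j × P i × P j
  ; adj?     = λ i j → adj? G i j ×-dec (P? i ×-dec P? j)
  ; adj-sym  = λ (a , p , q) → adj-sym G a , q , p
  ; loopless = loopless G ∘ proj₁
  }

arcs-remove : (G : Graph (suc n)) (v : Fin (suc n)) → arcs G ≡ 2 * degree G v + arcs (G ∖ v)
arcs-remove G v = sum₂-remove (adj G) v (adj-comm G) (adj-irrefl G v)

triangles-remove : (G : Graph (suc n)) (v : Fin (suc n)) →
                   triangles G ≡ 3 * link G v + triangles (G ∖ v)
triangles-remove G v = sum₃-remove (onTriangle G) v (onTriangle-swap₁₂ G) (onTriangle-swap₂₃ G)
  λ k → cong (_* (adj G v k * adj G v k)) (adj-irrefl G v)

adj-inside : (G : Graph n) (v : Fin n) → ∀ j k → adj (G ∣ᴳ adj? G v) j k ≡ onTriangle G v j k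
adj-inside G v j k = trans (𝟙-×₃ (adj? G j k) (adj? G v j) (adj? G v k))
  (rot (adj G j k) (adj G v j) (adj G v k))
  where
  rot : ∀ x y z → x * (y * z) ≡ y * (z * x)
  rot = solve-∀

link≡arcs : (G : Graph n) (v : Fin n) → link G v ≡ arcs (G ∣ᴳ adj? G v)
link≡arcs G v = sum₂-cong λ j k → sym (adj-inside G v j k)

link-remove : (G : Graph (suc n)) (v : Fin (suc n)) →
              link G v ≡ sum₂ λ j k → onTriangle G v (punchIn v j) (punchIn v k)
link-remove {n} G v = trans (sum-removeˡ (λ j → sum (onTriangle G v j)) v
    (trans (sum-cong-≗ {suc n} λ k → cong (_* (adj G v k * adj G v k)) (adj-irrefl G v))
      (trans (sum-const (suc n) 0) (*-zeroʳ n))))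
  (sum-cong-≗ λ j → sum-removeˡ (onTriangle G v (punchIn v j)) v
    (trans (cong (λ x → adj G v (punchIn v j) * (x * adj G (punchIn v j) v)) (adj-irrefl G v))
      (*-zeroʳ (adj G v (punchIn v j)))))

-- Cliques as subsets

count : {P : A → Set} → Decidable₁ P → List A → ℕ
count P? xs = length (filter P? xs)

count-cong : {P Q : A → Set} (P? : Decidable₁ P) (Q? : Decidable₁ Q) →
             (∀ {x} → P x → Q x) → (∀ {x} → Q x → P x) → ∀ xs → count P? xs ≡ count Q? xs
count-cong P? Q? f g xs = cong length (filter-≐ P? Q? (f , g) xs)

count-none : {P : A → Set} (P? : Decidable₁ P) → (∀ x → ¬ P x) → ∀ xs → count P? xs ≡ 0
count-none P? ¬P [] = refl
count-none P? ¬P (x ∷ xs) with P? x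
... | yes px = contradiction px (¬P x)
... | no _   = count-none P? ¬P xs

count-map : {P : A′ → Set} (P? : Decidable₁ P) (f : A → A′) → ∀ xs → count P? (map f xs) ≡ count (P? ∘ f) xs
count-map P? f [] = refl
count-map P? f (x ∷ xs) with P? (f x)
... | yes _ = cong suc (count-map P? f xs)
... | no _  = count-map P? f xs

count-subsets : {P : Subset (suc n) → Set} (P? : Decidable₁ P) →
                count P? (subsets (suc n)) ≡
                count (P? ∘ (inside Vec.∷_)) (subsets n) + count (P? ∘ (outside Vec.∷_)) (subsets n)
count-subsets {n} P? = begin
  count P? (ins ++ outs)                          ≡⟨ cong length (filter-++ P? ins outs) ⟩
  length (filter P? ins ++ filter P? outs)        ≡⟨ length-++ (filter P? ins) ⟩
  count P? ins + count P? outs                    ≡⟨ cong₂ _+_ (count-map P? _ (subsets n)) (count-map P? _ (subsets n)) ⟩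
  count (P? ∘ (inside Vec.∷_)) (subsets n) + count (P? ∘ (outside Vec.∷_)) (subsets n) ∎
  where
  open ≡-Reasoning
  ins  = map (inside Vec.∷_) (subsets n)
  outs = map (outside Vec.∷_) (subsets n)

∣p∣≡0⇒∉ : (p : Subset n) → ∣ p ∣ ≡ 0 → ∀ {i} → ¬ i ∈ p
∣p∣≡0⇒∉ (outside Vec.∷ p) eq (there i∈p) = ∣p∣≡0⇒∉ p eq i∈p

∣p∣≡1⇒unique : (p : Subset n) → ∣ p ∣ ≡ 1 → ∀ {i j} → i ∈ p → j ∈ p → i ≡ j
∣p∣≡1⇒unique (inside  Vec.∷ p) eq here here = refl
∣p∣≡1⇒unique (inside  Vec.∷ p) eq here (there j∈p) = contradiction j∈p (∣p∣≡0⇒∉ p (suc-injective eq))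
∣p∣≡1⇒unique (inside  Vec.∷ p) eq (there i∈p) _ = contradiction i∈p (∣p∣≡0⇒∉ p (suc-injective eq))
∣p∣≡1⇒unique (outside Vec.∷ p) eq (there i∈p) (there j∈p) = cong suc (∣p∣≡1⇒unique p eq i∈p j∈p)

∣p∣≥1⇒nonempty : (p : Subset n) → 1 ≤ ∣ p ∣ → ∃ λ i → i ∈ p
∣p∣≥1⇒nonempty (inside  Vec.∷ p) _ = zero , here
∣p∣≥1⇒nonempty (outside Vec.∷ p) 1≤ with i , i∈p ← ∣p∣≥1⇒nonempty p 1≤ = suc i , there i∈p

∣p∣≥2⇒another : (p : Subset n) → 2 ≤ ∣ p ∣ → ∀ {j} → j ∈ p → ∃ λ i → i ∈ p × i ≢ j
∣p∣≥2⇒another (inside  Vec.∷ p) 2≤ here with i , i∈p ← ∣p∣≥1⇒nonempty p (s≤s⁻¹ 2≤) =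
  suc i , there i∈p , λ ()
∣p∣≥2⇒another (inside  Vec.∷ p) 2≤ (there j∈p) = zero , here , λ ()
∣p∣≥2⇒another (outside Vec.∷ p) 2≤ (there j∈p) with i , i∈p , i≢j ← ∣p∣≥2⇒another p 2≤ j∈p =
  suc i , there i∈p , i≢j ∘ Fin.suc-injective

count-empty : ∀ n → count (λ p → ∣ p ∣ ℕ.≟ 0) (subsets n) ≡ 1
count-empty zero    = refl
count-empty (suc n) = trans (count-subsets {n} _)
  (cong₂ _+_ (count-none {P = λ p → ∣ inside Vec.∷ p ∣ ≡ 0} _ (λ _ ()) (subsets n)) (count-empty n))

Singleton : (Fin n → Set) → Subset n → Set
Singleton P p = ∣ p ∣ ≡ 1 × (∀ i → i ∈ p → P i)

count-singletons : {P : Fin n → Set} (P? : ∀ i → Dec (P i)) (S? : Decidable₁ (Singleton P)) →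
                   count S? (subsets n) ≡ sum (𝟙 ∘ P?)
count-singletons {zero} P? S? = count-none S? (λ { Vec.[] (() , _) }) (subsets 0)
count-singletons {suc n} {P} P? S? = trans (count-subsets S?) (cong₂ _+_ with-zero without-zero)
  where
  with-zero : count (S? ∘ (inside Vec.∷_)) (subsets n) ≡ 𝟙 (P? zero)
  with-zero with P? zero
  ... | yes P0 = trans (count-cong (S? ∘ (inside Vec.∷_)) (λ p → ∣ p ∣ ℕ.≟ 0)
      (λ (eq , _) → suc-injective eq)
      (λ {p} eq → cong suc eq , λ { zero _ → P0 ; (suc i) (there i∈p) → contradiction i∈p (∣p∣≡0⇒∉ p eq) })
      (subsets n)) (count-empty n)
  ... | no ¬P0 = count-none (S? ∘ (inside Vec.∷_)) (λ p (_ , h) → ¬P0 (h zero here)) (subsets n)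
  tail? : Decidable₁ (Singleton (P ∘ suc))
  tail? p = (∣ p ∣ ℕ.≟ 1) ×-dec all? λ i → (i ∈? p) →-dec P? (suc i)
  without-zero : count (S? ∘ (outside Vec.∷_)) (subsets n) ≡ sum (𝟙 ∘ P? ∘ suc)
  without-zero = trans (count-cong (S? ∘ (outside Vec.∷_)) tail?
      (λ (eq , h) → eq , λ i i∈p → h (suc i) (there i∈p))
      (λ (eq , h) → eq , λ { (suc i) (there i∈p) → h i i∈p }) (subsets n))
    (count-singletons (P? ∘ suc) tail?)

clique-outside : (G : Graph (suc n)) (s : ℕ) →
                 count (isClique? G s ∘ (outside Vec.∷_)) (subsets n) ≡ #K s (G ∖ zero)
clique-outside {n} G s = count-cong (isClique? G s ∘ (outside Vec.∷_)) (isClique? (G ∖ zero) s)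
  (λ (eq , h) → eq , λ i j i∈p j∈p i≢j → h (suc i) (suc j) (there i∈p) (there j∈p) (i≢j ∘ Fin.suc-injective))
  (λ { (eq , h) → eq , λ { (suc i) (suc j) (there i∈p) (there j∈p) i≢j → h i j i∈p j∈p (i≢j ∘ cong suc) } })
  (subsets n)

2*#K₂≡arcs : (G : Graph n) → 2 * #K 2 G ≡ arcs G
2*#K₂≡arcs {zero}  G = refl
2*#K₂≡arcs {suc n} G = begin
  2 * #K 2 G
    ≡⟨ cong (2 *_) (trans (count-subsets (isClique? G 2)) (cong₂ _+_ with-zero (clique-outside G 2))) ⟩
  2 * (sum (adj G zero ∘ suc) + #K 2 (G ∖ zero))
    ≡⟨ *-distribˡ-+ 2 (sum (adj G zero ∘ suc)) (#K 2 (G ∖ zero)) ⟩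
  2 * sum (adj G zero ∘ suc) + 2 * #K 2 (G ∖ zero)
    ≡⟨ cong₂ (λ d a → 2 * d + a) (sym (sum-removeˡ (adj G zero) zero (adj-irrefl G zero)))
         (2*#K₂≡arcs (G ∖ zero)) ⟩
  2 * degree G zero + arcs (G ∖ zero)
    ≡⟨ sym (arcs-remove G zero) ⟩
  arcs G ∎
  where
  open ≡-Reasoning
  single? : Decidable₁ (Singleton (Adj G zero ∘ suc))
  single? p = (∣ p ∣ ℕ.≟ 1) ×-dec all? λ i → (i ∈? p) →-dec adj? G zero (suc i)
  with-zero : count (isClique? G 2 ∘ (inside Vec.∷_)) (subsets n) ≡ sum (adj G zero ∘ suc)
  with-zero = trans (count-cong (isClique? G 2 ∘ (inside Vec.∷_)) single?
      (λ (eq , h) → suc-injective eq , λ i i∈p → h zero (suc i) here (there i∈p) λ ())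
      (λ {p} (eq , h) → cong suc eq , λ
        { zero zero _ _ 0≢0 → contradiction refl 0≢0
        ; zero (suc j) _ (there j∈p) _ → h j j∈p
        ; (suc i) zero (there i∈p) _ _ → adj-sym G (h i i∈p)
        ; (suc i) (suc j) (there i∈p) (there j∈p) i≢j → contradiction (cong suc (∣p∣≡1⇒unique p eq i∈p j∈p)) i≢j })
      (subsets n))
    (count-singletons (λ i → adj? G zero (suc i)) single?)

-- A triangle through `zero` is an edge of `N₀`, the rest of the graph with only the edges inside
-- the neighbourhood of `zero`. The recursion thus follows `triangles-remove`.
6*#K₃≡triangles : (G : Graph n) → 6 * #K 3 G ≡ triangles G
6*#K₃≡triangles {zero}  G = refl
6*#K₃≡triangles {suc n} G = begin
  6 * #K 3 G
    ≡⟨ cong (6 *_) (trans (count-subsets (isClique? G 3)) (cong₂ _+_ with-zero (clique-outside G 3))) ⟩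
  6 * (#K 2 N₀ + #K 3 (G ∖ zero))
    ≡⟨ regroup (#K 2 N₀) (#K 3 (G ∖ zero)) ⟩
  3 * (2 * #K 2 N₀) + 6 * #K 3 (G ∖ zero)
    ≡⟨ cong₂ (λ x y → 3 * x + y) (trans (2*#K₂≡arcs N₀) arcs≡link) (6*#K₃≡triangles (G ∖ zero)) ⟩
  3 * link G zero + triangles (G ∖ zero)
    ≡⟨ sym (triangles-remove G zero) ⟩
  triangles G ∎
  where
  open ≡-Reasoning
  N₀ = (G ∖ zero) ∣ᴳ (adj? G zero ∘ suc)
  regroup : ∀ x y → 6 * (x + y) ≡ 3 * (2 * x) + 6 * y
  regroup = solve-∀
  with-zero : count (isClique? G 3 ∘ (inside Vec.∷_)) (subsets n) ≡ #K 2 N₀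
  with-zero = count-cong (isClique? G 3 ∘ (inside Vec.∷_)) (isClique? N₀ 2)
    (λ (eq , h) → suc-injective eq , λ i j i∈p j∈p i≢j →
      h (suc i) (suc j) (there i∈p) (there j∈p) (i≢j ∘ Fin.suc-injective) ,
      h zero (suc i) here (there i∈p) (λ ()) , h zero (suc j) here (there j∈p) (λ ()))
    (λ {p} (eq , h) →
      -- `N₀` records adjacency to `zero` only on its edges, so a second vertex of `p` is needed to
      -- read it off.
      let adj₀ : ∀ j → j ∈ p → Adj G zero (suc j)
          adj₀ j j∈p = let i , i∈p , i≢j = ∣p∣≥2⇒another p (≤-reflexive (sym eq)) j∈p
                       in proj₂ (proj₂ (h i j i∈p j∈p i≢j))
      in cong suc eq , λ
        { zero zero _ _ 0≢0 → contradiction refl 0≢0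
        ; zero (suc j) _ (there j∈p) _ → adj₀ j j∈p
        ; (suc i) zero (there i∈p) _ _ → adj-sym G (adj₀ i i∈p)
        ; (suc i) (suc j) (there i∈p) (there j∈p) i≢j → proj₁ (h i j i∈p j∈p (i≢j ∘ cong suc)) })
    (subsets n)
  arcs≡link : arcs N₀ ≡ link G zero
  arcs≡link = trans (sum₂-cong λ j k → adj-inside G zero (suc j) (suc k)) (sym (link-remove G zero))

-- Links and codegrees in C₅-free graphs

module _ (G : Graph n) {a b c d e : Fin n}
         (ab : Adj G a b) (bc : Adj G b c) (cd : Adj G c d) (de : Adj G d e) (ea : Adj G e a)
         (a≢c : a ≢ c) (a≢d : a ≢ d) (b≢d : b ≢ d) (b≢e : b ≢ e) (c≢e : c ≢ e) where

  private
    v : Fin 5 → Fin n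
    v = lookup (a ∷ b ∷ c ∷ d ∷ e ∷ [])

    next : Fin 5 → Fin 5
    next 0F = 1F
    next 1F = 2F
    next 2F = 3F
    next 3F = 4F
    next 4F = 0F

    toℕ-next : ∀ i → toℕ (next i) ≡ suc (toℕ i) % 5
    toℕ-next 0F = refl
    toℕ-next 1F = refl
    toℕ-next 2F = refl
    toℕ-next 3F = refl
    toℕ-next 4F = refl

    step : ∀ i → Adj G (v i) (v (next i))
    step 0F = ab
    step 1F = bc
    step 2F = cd
    step 3F = de
    step 4F = ea

    follow : ∀ i j → toℕ j ≡ suc (toℕ i) % 5 → Adj G (v i) (v j)
    follow i j eq = subst (λ j → Adj G (v i) (v j)) (toℕ-injective (trans (toℕ-next i) (sym eq))) (step i)

  -- Cyclic neighbours differ by looplessness, so only the five diagonals appear as hypotheses.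
  pentagon : C 5 ⊑ G
  pentagon = record
    { embed     = v
    ; injective = λ {i} {j} → lookup-injective
        ((adj≢ G ab ∷ a≢c ∷ a≢d ∷ adj≢ G ea ∘ sym ∷ []) ∷
         (adj≢ G bc ∷ b≢d ∷ b≢e ∷ []) ∷
         (adj≢ G cd ∷ c≢e ∷ []) ∷
         (adj≢ G de ∷ []) ∷ [] ∷ []) i j
    ; preserves = λ
        { {i} {j} (_ , inj₁ j≡i+1) → follow i j j≡i+1
        ; {i} {j} (_ , inj₂ i≡j+1) → adj-sym G (follow j i i≡j+1) }
    }

avoidTwo : {P : Fin n → Set} (P? : ∀ i → Dec (P i)) → 3 ≤ sum (λ i → 𝟙 (P? i)) →
        ∀ u v → ∃ λ i → P i × i ≢ u × i ≢ v
avoidTwo {P = P} P? 3≤∑ u v with any? (λ i → P? i ×-dec (¬? (i ≟ u) ×-dec ¬? (i ≟ v)))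
... | yes found = found
... | no  none  = contradiction (≤-trans 3≤∑ (count-pair P? u v only)) λ { (s≤s (s≤s ())) }
  where
  only : ∀ i → P i → i ≡ u ⊎ i ≡ v
  only i p with i ≟ u | i ≟ v
  ... | yes i≡u | _       = inj₁ i≡u
  ... | no  _   | yes i≡v = inj₂ i≡v
  ... | no  i≢u | no  i≢v = contradiction (i , p , i≢u , i≢v) none

-- The path is p, j, k, q; the three inequations together with looplessness make its four vertices
-- distinct.
P₄-Free : Graph n → Set
P₄-Free G = ∀ {p j k q} → Adj G p j → Adj G j k → Adj G k q → p ≢ k → p ≢ q → j ≢ q → ⊥

-- Every edge of a P₄-free graph has an end of degree at most 2.
P₄-Free⇒arcs≤ : (G : Graph n) → P₄-Free G → (χ : Fin n → ℕ) → (∀ {i j} → Adj G i j → 1 ≤ χ i) →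
                arcs G ≤ 4 * sum χ
P₄-Free⇒arcs≤ {n} G free χ cover = begin
  arcs G
    ≤⟨ sum₂-mono charge ⟩
  sum₂ (λ i j → low i * adj G i j + low j * adj G j i)
    ≡⟨ sum₂-distrib-+ (λ i j → low i * adj G i j) (λ i j → low j * adj G j i) ⟩
  sum₂ (λ i j → low i * adj G i j) + sum₂ (λ i j → low j * adj G j i)
    ≡⟨ cong (sum₂ (λ i j → low i * adj G i j) +_) (∑-comm (λ i j → low j * adj G j i)) ⟩
  sum₂ (λ i j → low i * adj G i j) + sum₂ (λ i j → low i * adj G i j)
    ≤⟨ +-mono-≤ half half ⟩
  2 * sum χ + 2 * sum χ
    ≡⟨ regroup (sum χ) ⟩
  4 * sum χ ∎
  where
  open ≤-Reasoning
  low : Fin n → ℕ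
  low i = 𝟙 (degree G i ≤? 2)
  regroup : ∀ s → 2 * s + 2 * s ≡ 4 * s
  regroup = solve-∀
  charge : ∀ i j → adj G i j ≤ low i * adj G i j + low j * adj G j i
  charge i j = 𝟙-≤ (adj? G i j) λ ij → lowEnd ij (degree G i ≤? 2) (degree G j ≤? 2)
    where
    lowEnd : Adj G i j → (d? : Dec (degree G i ≤ 2)) (e? : Dec (degree G j ≤ 2)) →
             1 ≤ 𝟙 d? * adj G i j + 𝟙 e? * adj G j i
    lowEnd ij (yes _) _ = ≤-trans (≤-reflexive (sym (trans (*-identityˡ _) (𝟙-yes (adj? G i j) ij)))) (m≤m+n _ _)
    lowEnd ij (no _) (yes _) = ≤-reflexive (sym (trans (*-identityˡ _) (𝟙-yes (adj? G j i) (adj-sym G ij))))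
    -- With three neighbours at each end there are a neighbour p of i and a neighbour q of j that
    -- extend the edge to the path p, i, j, q.
    lowEnd ij (no di) (no dj)
      with p , ip , p≢j , _ ← avoidTwo (adj? G i) (≰⇒> di) j j
      with q , jq , q≢i , q≢p ← avoidTwo (adj? G j) (≰⇒> dj) i p =
      ⊥-elim (free (adj-sym G ip) ij jq p≢j (q≢p ∘ sym) (q≢i ∘ sym))
  -- A vertex with `χ i` = 0 is isolated, so its degree costs nothing; this allows a bound by the
  -- number of vertices in N(x) rather than by n.
  weight : ∀ i (d? : Dec (degree G i ≤ 2)) → 𝟙 d? * degree G i ≤ 2 * χ i
  weight i (no _) = z≤n
  weight i (yes d≤2) with degree G i in eq
  ... | zero = z≤n
  ... | suc d with j , 0<ij ← sum-pos (adj G i) (subst (0 <_) (sym eq) z<s) =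
    ≤-trans (≤-trans (≤-reflexive (*-identityˡ (suc d))) d≤2)
      (*-monoʳ-≤ 2 (cover (𝟙-pos (adj? G i j) 0<ij)))
  half : sum₂ (λ i j → low i * adj G i j) ≤ 2 * sum χ
  half = begin
    sum₂ (λ i j → low i * adj G i j)  ≡⟨ sum-cong-≗ (λ i → sym (*-distribˡ-sum (low i) (adj G i))) ⟩
    sum (λ i → low i * degree G i)    ≤⟨ sum-mono (λ i → weight i (degree G i ≤? 2)) ⟩
    sum (λ i → 2 * χ i)               ≡⟨ sym (*-distribˡ-sum 2 χ) ⟩
    2 * sum χ                         ∎

module C₅-Free (G : Graph n) (free : (C 5 -Free) G) where

  -- A path on four vertices inside N(x) closes to a 5-cycle through x.
  link-P₄-free : ∀ x → P₄-Free (G ∣ᴳ adj? G x)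
  link-P₄-free x (pj , xp , xj) (jk , _ , xk) (kq , _ , xq) p≢k p≢q j≢q =
    free (pentagon G xp pj jk kq (adj-sym G xq) (adj≢ G xj) (adj≢ G xk) p≢k p≢q j≢q)

  link≤4*degree : ∀ x → link G x ≤ 4 * degree G x
  link≤4*degree x = ≤-trans (≤-reflexive (link≡arcs G x))
    (P₄-Free⇒arcs≤ (G ∣ᴳ adj? G x) (link-P₄-free x) (adj G x)
      λ (_ , xi , _) → ≤-reflexive (sym (𝟙-yes (adj? G x _) xi)))

  triangles≤4*arcs : triangles G ≤ 4 * arcs G
  triangles≤4*arcs = ≤-trans (sum-mono link≤4*degree) (≤-reflexive (sym (*-distribˡ-sum 4 (degree G))))

  -- Any further common neighbour q closes the 5-cycle q, a, a′, x, b.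
  commonNeighbour : ∀ {x a a′ b q} → Adj G x a → Adj G x a′ → Adj G a a′ → Adj G x b → a ≢ b → a′ ≢ b →
                    Adj G a q → Adj G b q → q ≡ x ⊎ q ≡ a′
  commonNeighbour {x} {a} {a′} {b} {q} xa xa′ aa′ xb a≢b a′≢b aq bq with q ≟ x | q ≟ a′
  ... | yes q≡x | _        = inj₁ q≡x
  ... | no  _   | yes q≡a′ = inj₂ q≡a′
  ... | no  q≢x | no  q≢a′ = contradiction
    (pentagon G (adj-sym G aq) aa′ (adj-sym G xa′) xb bq q≢a′ q≢x (adj≢ G xa ∘ sym) a≢b a′≢b) free

  codegree≤2 : ∀ {x a a′ b} → Adj G x a → Adj G x a′ → Adj G a a′ → Adj G x b → a ≢ b → a′ ≢ b →
               codegree G a b ≤ 2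
  codegree≤2 {x} {a} {a′} {b} xa xa′ aa′ xb a≢b a′≢b = begin
    sum (λ q → adj G a q * adj G b q)
      ≡⟨ sum-cong-≗ (λ q → sym (𝟙-× (adj? G a q) (adj? G b q))) ⟩
    sum (λ q → 𝟙 (adj? G a q ×-dec adj? G b q))
      ≤⟨ count-pair (λ q → adj? G a q ×-dec adj? G b q) x a′
           (λ q (aq , bq) → commonNeighbour xa xa′ aa′ xb a≢b a′≢b aq bq) ⟩
    2 ∎
    where open ≤-Reasoning

  -- Two triangles x y p and x y q on a common edge: `codegree≤2` applies to the triangle x, p, y
  -- and the further neighbour q of x.
  pages-codegree≤2 : ∀ {x y p q} → Adj G x y → Adj G x p → Adj G y p → Adj G x q → Adj G y q → p ≢ q →
                     codegree G p q ≤ 2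
  pages-codegree≤2 xy xp yp xq yq p≢q = codegree≤2 xp xy (adj-sym G yp) xq p≢q (adj≢ G yq)

sum-lower : {f : Fin n → ℕ} {c : ℕ} → (∀ i → c ≤ f i) → n * c ≤ sum f
sum-lower {n} {c = c} c≤f = ≤-trans (≤-reflexive (sym (sum-const n c))) (sum-mono c≤f)

-- Sparse vertices

-- For s ones among the entries this is s ≤ 1 + s(s - 1), a crude form of inclusion-exclusion. One
-- index l with entry 1 pays for itself, and every other i is charged to the pair (i, l).
sum≤1+pairs : (x : Fin k → ℕ) → (∀ i → x i ≤ 1) →
              sum x ≤ 1 + sum₂ λ i j → 𝟙 (¬? (i ≟ j)) * (x i * x j)
sum≤1+pairs x x≤1 with sum x in eq
... | zero  = z≤n
... | suc _ with l , 0<xl ← sum-pos x (subst (0 <_) (sym eq) z<s) = begin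
  suc _                                                    ≡⟨ sym eq ⟩
  sum x                                                    ≤⟨ sum-mono bound ⟩
  sum (λ i → 𝟙 (i ≟ l) + sum (pair i))                     ≡⟨ ∑-distrib-+ (λ i → 𝟙 (i ≟ l)) (λ i → sum (pair i)) ⟩
  sum (λ i → 𝟙 (i ≟ l)) + sum₂ pair                        ≡⟨ cong (_+ sum₂ pair) (sum-singleton l) ⟩
  1 + sum₂ pair                                            ∎
  where
  open ≤-Reasoning
  pair : _ → _ → ℕ
  pair i j = 𝟙 (¬? (i ≟ j)) * (x i * x j)
  bound : ∀ i → x i ≤ 𝟙 (i ≟ l) + sum (pair i)
  bound i with i ≟ l
  ... | yes _   = ≤-trans (x≤1 i) (m≤m+n 1 _)
  ... | no  i≢l = ≤-trans (≤-reflexive (sym pair-l)) (term≤sum (pair i) l)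
    where
    pair-l : pair i l ≡ x i
    pair-l = trans (cong (_* (x i * x l)) (𝟙-yes (¬? (i ≟ l)) i≢l))
      (trans (*-identityˡ _) (trans (cong (x i *_) (≤-antisym (x≤1 l) 0<xl)) (*-identityʳ (x i))))

-- Almost disjoint neighbourhoods must fit into n vertices. Each vertex q is counted once for free,
-- and its further occurrences are charged to ordered pairs of neighbourhoods containing it; there
-- are at most k² pairs, each charged at most c times.
∑degree-spread : (G : Graph n) (v : Fin k → Fin n) (c : ℕ) →
                 (∀ i j → i ≢ j → codegree G (v i) (v j) ≤ c) →
                 sum (degree G ∘ v) ≤ n + k * (k * c)
∑degree-spread {n} {k} G v c spread = begin
  sum (λ i → sum (adj G (v i)))
    ≡⟨ ∑-comm (λ i q → adj G (v i) q) ⟩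
  sum (λ q → sum (λ i → adj G (v i) q))
    ≤⟨ sum-mono (λ q → sum≤1+pairs (λ i → adj G (v i) q) (λ i → 𝟙≤1 (adj? G (v i) q))) ⟩
  sum (λ q → 1 + sum₂ λ i j → term i j q)
    ≡⟨ ∑-distrib-+ (λ q → 1) (λ q → sum₂ λ i j → term i j q) ⟩
  sum {n} (λ q → 1) + sum (λ q → sum₂ λ i j → term i j q)
    ≡⟨ cong₂ _+_ (trans (sum-const n 1) (*-identityʳ n)) (trans (∑-comm (λ q i → sum λ j → term i j q))
         (sum-cong-≗ λ i → ∑-comm (λ q j → term i j q))) ⟩
  n + sum₂ (λ i j → sum (term i j))
    ≤⟨ +-monoʳ-≤ n (sum-bound {c = k * c} λ i → sum-bound {c = c} (pair i)) ⟩
  n + k * (k * c) ∎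
  where
  open ≤-Reasoning
  term : Fin k → Fin k → Fin n → ℕ
  term i j q = 𝟙 (¬? (i ≟ j)) * (adj G (v i) q * adj G (v j) q)
  pair : ∀ i j → sum (term i j) ≤ c
  pair i j with i ≟ j
  ... | yes _   = ≤-trans (≤-reflexive (trans (sum-const n 0) (*-zeroʳ n))) z≤n
  ... | no  i≢j = ≤-trans (≤-reflexive (sum-cong-≗ {n} λ q → *-identityˡ (adj G (v i) q * adj G (v j) q)))
    (spread i j i≢j)

triangle : (G : Graph n) → 0 < triangles G → ∃ λ x → ∃₂ λ y z → Adj G x y × Adj G x z × Adj G y z
triangle G 0<T
  with x , 0<Lx ← sum-pos (link G) 0<T
  with y , 0<Ly ← sum-pos _ 0<Lx
  with z , 0<xyz ← sum-pos _ 0<Ly =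
  x , y , z , 𝟙-pos (triangle? G x y z) (subst (0 <_) (onTriangle≡𝟙 G x y z) 0<xyz)

-- The negation of sparseness: `2 * degree` and `link` count the edges and the triangles at w twice,
-- so `dense` says that every vertex lies in more than 9n/20 of them.
module _ (G : Graph n) (free : (C 5 -Free) G) (large : 5880 < n)
         (dense : ∀ w → 9 * n < 10 * (2 * degree G w + link G w)) where

  open C₅-Free G free

  private
    3n≤20degree : ∀ w → 3 * n ≤ 20 * degree G w
    3n≤20degree w = *-cancelˡ-≤ 3 (begin
      3 * (3 * n)                            ≡⟨ *-assoc 3 3 n ⟨
      9 * n                                  ≤⟨ <⇒≤ (dense w) ⟩
      10 * (2 * degree G w + link G w)       ≤⟨ *-monoʳ-≤ 10 (+-monoʳ-≤ (2 * degree G w) (link≤4*degree w)) ⟩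
      10 * (2 * degree G w + 4 * degree G w) ≡⟨ regroup (degree G w) ⟩
      3 * (20 * degree G w)                  ∎)
      where
      open ≤-Reasoning
      regroup : ∀ d → 10 * (2 * d + 4 * d) ≡ 3 * (20 * d)
      regroup = solve-∀

    -- The seven degrees add up to at least 21 n / 20, but overlaps account for
    -- at most 7 · 7 · 6 = 294 = 5880 / 20.
    no-7-spread : (v : Fin 7 → Fin n) → ¬ (∀ i j → i ≢ j → codegree G (v i) (v j) ≤ 6)
    no-7-spread v spread = <⇒≱ large (+-cancelʳ-≤ (20 * n) n 5880 (begin
      21 * n                            ≡⟨ *-assoc 7 3 n ⟩
      7 * (3 * n)                       ≤⟨ sum-lower (3n≤20degree ∘ v) ⟩
      sum (λ i → 20 * degree G (v i))   ≡⟨ *-distribˡ-sum 20 (degree G ∘ v) ⟨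
      20 * sum (degree G ∘ v)           ≤⟨ *-monoʳ-≤ 20 (∑degree-spread G v 6 spread) ⟩
      20 * (n + 294)                    ≡⟨ *-distribˡ-+ 20 n 294 ⟩
      20 * n + 5880                     ≡⟨ +-comm (20 * n) 5880 ⟩
      5880 + 20 * n                     ∎))
      where open ≤-Reasoning

    spread⇒≤6 : {P : Fin n → Set} (P? : ∀ i → Dec (P i)) →
                (∀ {i j} → P i → P j → i ≢ j → codegree G i j ≤ 6) → sum (λ i → 𝟙 (P? i)) ≤ 6
    spread⇒≤6 P? spread with sum (λ i → 𝟙 (P? i)) ≤? 6
    ... | yes ≤6 = ≤6
    ... | no  ≰6 with v , v-inj , Pv ← choose P? (≰⇒> ≰6) =
      contradiction (λ i j i≢j → spread (Pv i) (Pv j) (i≢j ∘ v-inj)) (no-7-spread v)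

    -- Seven common neighbours of x and y would have pairwise codegree at most 2, which
    -- `no-7-spread` excludes.
    edge-codegree≤6 : ∀ {x y} → Adj G x y → codegree G x y ≤ 6
    edge-codegree≤6 {x} {y} xy = ≤-trans
      (≤-reflexive (sum-cong-≗ λ q → sym (𝟙-× (adj? G x q) (adj? G y q))))
      (spread⇒≤6 (λ q → adj? G x q ×-dec adj? G y q)
        λ (xp , yp) (xq , yq) p≢q → ≤-trans (pages-codegree≤2 xy xp yp xq yq p≢q) (m≤n+m 2 4))

    InLink : Fin n → Fin n → Set
    InLink x j = Adj G x j × ∃ λ k → Adj G x k × Adj G j k

    inLink? : ∀ x j → Dec (InLink x j)
    inLink? x j = adj? G x j ×-dec any? λ k → adj? G x k ×-dec adj? G j k

    -- Let k be a neighbour of i inside N(x). If k is j, then i and j form an edge; otherwise the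
    -- triangle x, i, k and the further neighbour j of x leave at most two common neighbours. The
    -- first case is why the spread condition allows 6 and not just 2.
    inLink-spread : ∀ x {i j} → InLink x i → InLink x j → i ≢ j → codegree G i j ≤ 6
    inLink-spread x {i} {j} (xi , k , xk , ik) (xj , _) i≢j with k ≟ j
    ... | yes refl = edge-codegree≤6 ik
    ... | no  k≢j  = ≤-trans (codegree≤2 xi xk ik xj i≢j k≢j) (m≤n+m 2 4)

    -- At most six vertices of N(x) have a neighbour inside N(x), and each has at most six of them
    -- by `edge-codegree≤6`.
    link≤36 : ∀ x → link G x ≤ 36
    link≤36 x = begin
      link G x                                 ≡⟨ link≡∑codegree G x ⟩
      sum (λ j → adj G x j * codegree G x j)   ≤⟨ sum-mono (λ j → bound j (adj? G x j)) ⟩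
      sum (λ j → 6 * 𝟙 (inLink? x j))      ≡⟨ *-distribˡ-sum 6 (λ j → 𝟙 (inLink? x j)) ⟨
      6 * sum (λ j → 𝟙 (inLink? x j))      ≤⟨ *-monoʳ-≤ 6 (spread⇒≤6 (inLink? x) (inLink-spread x)) ⟩
      36                                       ∎
      where
      open ≤-Reasoning
      bound : ∀ j (xj? : Dec (Adj G x j)) → 𝟙 xj? * codegree G x j ≤ 6 * 𝟙 (inLink? x j)
      bound j (no _)   = z≤n
      bound j (yes xj) with codegree G x j in eq
      ... | zero  = z≤n
      ... | suc c
        with k , 0<xjk ← sum-pos (λ k → adj G x k * adj G j k) (subst (0 <_) (sym eq) z<s) = begin
        suc c + 0                    ≡⟨ +-identityʳ (suc c) ⟩
        suc c                        ≡⟨ eq ⟨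
        codegree G x j               ≤⟨ edge-codegree≤6 xj ⟩
        6 * 1                        ≡⟨ cong (6 *_) (𝟙-yes (inLink? x j) (xj , k , 𝟙-pos (adj? G x k ×-dec adj? G j k)
                                          (subst (0 <_) (sym (𝟙-× (adj? G x k) (adj? G j k))) 0<xjk))) ⟨
        6 * 𝟙 (inLink? x j)      ∎

    -- Since the link is now bounded by a constant, density has to come from the degree alone; this
    -- improves 3n/20 to 9n/20 - 18.
    9n≤20degree+360 : ∀ w → 9 * n ≤ 20 * (degree G w + 18)
    9n≤20degree+360 w = begin
      9 * n                              ≤⟨ <⇒≤ (dense w) ⟩
      10 * (2 * degree G w + link G w)   ≤⟨ *-monoʳ-≤ 10 (+-monoʳ-≤ (2 * degree G w) (link≤36 w)) ⟩
      10 * (2 * degree G w + 36)         ≡⟨ regroup (degree G w) ⟩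
      20 * (degree G w + 18)             ∎
      where
      open ≤-Reasoning
      regroup : ∀ d → 10 * (2 * d + 36) ≡ 20 * (d + 18)
      regroup = solve-∀

  -- The three vertices of a triangle have pairwise codegree at most 6. Their degrees sum to at
  -- least 27n/20 - 54 with 54 = 3 · 18, but to at most n + 54 with 54 = 3 · 3 · 6, whence 7n ≤ 20 ·
  -- 108 = 2160.
  dense⇒no-triangle : ¬ (0 < triangles G)
  dense⇒no-triangle 0<T with x , y , z , xy , xz , yz ← triangle G 0<T =
    <⇒≱ large (≤-trans (m≤n*m n 7) (≤-trans (+-cancelʳ-≤ (20 * n) (7 * n) 2160 (begin
      7 * n + 20 * n                           ≡⟨ *-distribʳ-+ n 7 20 ⟨
      27 * n                                   ≡⟨ *-assoc 3 9 n ⟩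
      3 * (9 * n)                              ≤⟨ sum-lower (9n≤20degree+360 ∘ v) ⟩
      sum (λ i → 20 * (degree G (v i) + 18))   ≡⟨ *-distribˡ-sum 20 (λ i → degree G (v i) + 18) ⟨
      20 * sum (λ i → degree G (v i) + 18)     ≡⟨ cong (20 *_) (∑-distrib-+ (degree G ∘ v) (λ _ → 18)) ⟩
      20 * (sum (degree G ∘ v) + 54)           ≤⟨ *-monoʳ-≤ 20 (+-monoˡ-≤ 54 (∑degree-spread G v 6 spread)) ⟩
      20 * (n + 54 + 54)                       ≡⟨ cong (20 *_) (+-assoc n 54 54) ⟩
      20 * (n + 108)                           ≡⟨ *-distribˡ-+ 20 n 108 ⟩
      20 * n + 2160                            ≡⟨ +-comm (20 * n) 2160 ⟩
      2160 + 20 * n                            ∎)) (m≤m+n 2160 3720)))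
    where
    open ≤-Reasoning
    v : Fin 3 → Fin n
    v = lookup (x ∷ y ∷ z ∷ [])
    adjacent : ∀ i j → i ≢ j → Adj G (v i) (v j)
    adjacent 0F 0F i≢i = contradiction refl i≢i
    adjacent 0F 1F _ = xy
    adjacent 0F 2F _ = xz
    adjacent 1F 0F _ = adj-sym G xy
    adjacent 1F 1F i≢i = contradiction refl i≢i
    adjacent 1F 2F _ = yz
    adjacent 2F 0F _ = adj-sym G xz
    adjacent 2F 1F _ = adj-sym G yz
    adjacent 2F 2F i≢i = contradiction refl i≢i
    spread : ∀ i j → i ≢ j → codegree G (v i) (v j) ≤ 6
    spread i j i≢j = edge-codegree≤6 (adjacent i j i≢j)

sparseVertex : (G : Graph n) → (C 5 -Free) G → 5880 < n → 0 < triangles G →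
               ∃ λ w → 10 * (2 * degree G w + link G w) ≤ 9 * n
sparseVertex {n} G free large 0<T with any? (λ w → 10 * (2 * degree G w + link G w) ≤? 9 * n)
... | yes found = found
... | no  none  = contradiction 0<T (dense⇒no-triangle G free large λ w → ≰⇒> λ ≤9n → none (w , ≤9n))

-- Mantel's theorem

-- From (p + q)² = (q - p)² + 4pq with q = p + k. The product pq thus misses the quarter by the
-- floor of k²/4, which vanishes exactly for k ≤ 1.
quarter : ∀ p k → (p + (p + k)) ^ 2 / 4 ≡ k ^ 2 / 4 + p * (p + k)
quarter p k = begin
  (p + (p + k)) ^ 2 / 4               ≡⟨ /-congˡ {o = 4} (square p k) ⟩
  (k ^ 2 + p * (p + k) * 4) / 4       ≡⟨ +-distrib-/-∣ʳ (k ^ 2) {d = 4} (divides-refl (p * (p + k))) ⟩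
  k ^ 2 / 4 + p * (p + k) * 4 / 4     ≡⟨ cong (k ^ 2 / 4 +_) (m*n/n≡m (p * (p + k)) 4) ⟩
  k ^ 2 / 4 + p * (p + k)             ∎
  where
  open ≡-Reasoning
  square : ∀ p k → (p + (p + k)) * ((p + (p + k)) * 1) ≡ k * (k * 1) + p * (p + k) * 4
  square = solve-∀

module _ {p q : ℕ} (p≤q : p ≤ q) where

  private
    gap : ℕ
    gap = q ∸ p

    p+gap≡q : p + gap ≡ q
    p+gap≡q = m+[n∸m]≡n p≤q

    split : (p + q) ^ 2 / 4 ≡ gap ^ 2 / 4 + p * q
    split = subst (λ x → (p + x) ^ 2 / 4 ≡ gap ^ 2 / 4 + p * x) p+gap≡q (quarter p gap)

  ordered-product≤ : p * q ≤ (p + q) ^ 2 / 4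
  ordered-product≤ = ≤-trans (m≤n+m (p * q) (gap ^ 2 / 4)) (≤-reflexive (sym split))

  ordered-product≡ : q ≤ suc p → p * q ≡ (p + q) ^ 2 / 4
  ordered-product≡ q≤1+p = sym (trans split (cong (_+ p * q) (m<n⇒m/n≡0 (k²<4 gap gap≤1))))
    where
    gap≤1 : gap ≤ 1
    gap≤1 = +-cancelˡ-≤ p gap 1 (≤-trans (≤-reflexive p+gap≡q) (≤-trans q≤1+p (≤-reflexive (+-comm 1 p))))
    k²<4 : ∀ k → k ≤ 1 → k ^ 2 < 4
    k²<4 zero _ = s≤s z≤n
    k²<4 (suc zero) _ = s≤s (s≤s z≤n)
    k²<4 (suc (suc _)) (s≤s ())

  ordered-balanced : (p + q) ^ 2 / 4 ≤ p * q → q ≤ suc p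
  ordered-balanced quarter≤pq = ≤-trans (≤-reflexive (sym p+gap≡q))
    (≤-trans (+-monoʳ-≤ p (k≤1 gap (m/n≡0⇒m<n k²/4≡0))) (≤-reflexive (+-comm p 1)))
    where
    k²/4≡0 : gap ^ 2 / 4 ≡ 0
    k²/4≡0 = n≤0⇒n≡0 (+-cancelʳ-≤ (p * q) (gap ^ 2 / 4) 0 (≤-trans (≤-reflexive (sym split)) quarter≤pq))
    k≤1 : ∀ k → k ^ 2 < 4 → k ≤ 1
    k≤1 zero _ = z≤n
    k≤1 (suc zero) _ = s≤s z≤n
    k≤1 k@(suc (suc _)) k²<4 =
      contradiction (*-mono-≤ {2} {k} {2} {k * 1} (s≤s (s≤s z≤n)) (s≤s (s≤s z≤n))) (<⇒≱ k²<4)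

product-comm : ∀ p q → (p + q) ^ 2 / 4 ≡ (q + p) ^ 2 / 4
product-comm p q = cong (λ s → s ^ 2 / 4) (+-comm p q)

product≤quarter : ∀ p q → p * q ≤ (p + q) ^ 2 / 4
product≤quarter p q with ≤-total p q
... | inj₁ p≤q = ordered-product≤ p≤q
... | inj₂ q≤p = ≤-trans (≤-reflexive (*-comm p q)) (≤-trans (ordered-product≤ q≤p) (≤-reflexive (product-comm q p)))

balanced⇒product≡quarter : ∀ p q → p ≤ suc q → q ≤ suc p → p * q ≡ (p + q) ^ 2 / 4
balanced⇒product≡quarter p q p≤ q≤ with ≤-total p q
... | inj₁ p≤q = ordered-product≡ p≤q q≤
... | inj₂ q≤p = trans (*-comm p q) (trans (ordered-product≡ q≤p p≤) (product-comm q p))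

quarter≤product⇒balanced : ∀ p q → (p + q) ^ 2 / 4 ≤ p * q → p ≤ suc q × q ≤ suc p
quarter≤product⇒balanced p q ≤pq with ≤-total p q
... | inj₁ p≤q = m≤n⇒m≤1+n p≤q , ordered-balanced p≤q ≤pq
... | inj₂ q≤p =
  ordered-balanced q≤p (≤-trans (≤-reflexive (product-comm q p)) (≤-trans ≤pq (≤-reflexive (*-comm p q)))) ,
  m≤n⇒m≤1+n q≤p

4*quarter≤square : ∀ n → 4 * (n ^ 2 / 4) ≤ n * n
4*quarter≤square n = ≤-trans (≤-reflexive (*-comm 4 (n ^ 2 / 4)))
  (≤-trans (m/n*n≤m (n ^ 2) 4) (≤-reflexive (cong (n *_) (*-identityʳ n))))

-- Colour classes and complete bipartite graphs

classSize : (Fin n → Fin r) → Fin r → ℕ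
classSize c a = sum λ i → 𝟙 (c i ≟ a)

partSize≡classSize : (c : Fin n → Fin r) (a : Fin r) → partSize c a ≡ classSize c a
partSize≡classSize {zero} c a = refl
partSize≡classSize {suc n} c a with c zero ≟ a
... | yes _ = cong suc (partSize≡classSize (c ∘ suc) a)
... | no  _ = partSize≡classSize (c ∘ suc) a

classSize₀+classSize₁ : (c : Fin n → Fin 2) → classSize c 0F + classSize c 1F ≡ n
classSize₀+classSize₁ {n} c = trans (sym (∑-distrib-+ (λ i → 𝟙 (c i ≟ 0F)) (λ i → 𝟙 (c i ≟ 1F))))
  (trans (sum-cong-≗ (λ i → one (c i))) (trans (sum-const n 1) (*-identityʳ n)))
  where
  one : ∀ a → 𝟙 (a ≟ 0F) + 𝟙 (a ≟ 1F) ≡ 1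
  one 0F = refl
  one 1F = refl

sum₂-product : (f : Fin m → ℕ) (g : Fin n → ℕ) → sum₂ (λ i j → f i * g j) ≡ sum f * sum g
sum₂-product f g = trans (sum-cong-≗ λ i → trans (sym (*-distribˡ-sum (f i) g)) (*-comm (f i) (sum g)))
  (trans (sym (*-distribˡ-sum (sum g) f)) (*-comm (sum g) (sum f)))

IsBipartition : Graph n → (Fin n → Fin 2) → Set
IsBipartition G c = ∀ i j → (Adj G i j → c i ≢ c j) × (c i ≢ c j → Adj G i j)

bipartition-arcs : (G : Graph n) (c : Fin n → Fin 2) → IsBipartition G c →
                   arcs G ≡ 2 * (classSize c 0F * classSize c 1F)
bipartition-arcs G c bip = begin
  arcs G
    ≡⟨ sum₂-cong (λ i j → trans (𝟙-cong (adj? G i j) (¬? (c i ≟ c j)) (proj₁ (bip i j)) (proj₂ (bip i j)))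
         (split (c i) (c j))) ⟩
  sum₂ (λ i j → 𝟙 (c i ≟ 0F) * 𝟙 (c j ≟ 1F) + 𝟙 (c i ≟ 1F) * 𝟙 (c j ≟ 0F))
    ≡⟨ sum₂-distrib-+ (λ i j → 𝟙 (c i ≟ 0F) * 𝟙 (c j ≟ 1F)) (λ i j → 𝟙 (c i ≟ 1F) * 𝟙 (c j ≟ 0F)) ⟩
  sum₂ (λ i j → 𝟙 (c i ≟ 0F) * 𝟙 (c j ≟ 1F)) + sum₂ (λ i j → 𝟙 (c i ≟ 1F) * 𝟙 (c j ≟ 0F))
    ≡⟨ cong₂ _+_ (sum₂-product (λ i → 𝟙 (c i ≟ 0F)) (λ j → 𝟙 (c j ≟ 1F)))
                 (sum₂-product (λ i → 𝟙 (c i ≟ 1F)) (λ j → 𝟙 (c j ≟ 0F))) ⟩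
  p * q + q * p
    ≡⟨ regroup p q ⟩
  2 * (p * q) ∎
  where
  open ≡-Reasoning
  p = classSize c 0F
  q = classSize c 1F
  regroup : ∀ p q → p * q + q * p ≡ 2 * (p * q)
  regroup = solve-∀
  split : ∀ a b → 𝟙 (¬? (a ≟ b)) ≡ 𝟙 (a ≟ 0F) * 𝟙 (b ≟ 1F) + 𝟙 (a ≟ 1F) * 𝟙 (b ≟ 0F)
  split 0F 0F = refl
  split 0F 1F = refl
  split 1F 0F = refl
  split 1F 1F = refl

colour : {P : Set} → Dec P → Fin 2
colour (yes _) = 1F
colour (no _)  = 0F

-- The non-neighbours of a vertex of maximum degree cover all edges of a
-- triangle-free graph.
module Mantel (G : Graph (suc n)) (triangle-free : triangles G ≡ 0) where

  v : Fin (suc n)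
  v = proj₁ (argmax (degree G))

  side : Fin (suc n) → Fin 2
  side i = colour (adj? G v i)

  private
    degree≤ : ∀ i → degree G i ≤ degree G v
    degree≤ = proj₂ (argmax (degree G))

    out : Fin (suc n) → ℕ
    out i = 𝟙 (side i ≟ 0F)

    out-pos : ∀ {i} → ¬ Adj G v i → out i ≡ 1
    out-pos {i} ¬vi with adj? G v i
    ... | yes vi = contradiction vi ¬vi
    ... | no _   = refl

    no-triangle : ∀ {i j} → Adj G v i → Adj G v j → ¬ Adj G i j
    no-triangle {i} {j} vi vj ij = contradiction (begin
      1
        ≡⟨ trans (onTriangle≡𝟙 G v i j) (𝟙-yes (triangle? G v i j) (vi , vj , ij)) ⟨
      onTriangle G v i j
        ≤⟨ ≤-trans (term≤sum (onTriangle G v i) j) (term≤sum (λ i → sum (onTriangle G v i)) i) ⟩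
      link G v
        ≤⟨ term≤sum (link G) v ⟩
      triangles G
        ≡⟨ triangle-free ⟩
      0 ∎) (λ ())
      where open ≤-Reasoning

    p = classSize side 0F
    q = classSize side 1F

    degree≡q : degree G v ≡ q
    degree≡q = sum-cong-≗ λ i → eq (adj? G v i)
      where
      eq : {P : Set} (P? : Dec P) → 𝟙 P? ≡ 𝟙 (colour P? ≟ 1F)
      eq (yes _) = refl
      eq (no _)  = refl

    -- Every arc is charged to those of its ends that lie outside N(v), so an arc with both ends
    -- outside is charged twice.
    cover : Fin (suc n) → Fin (suc n) → ℕ
    cover i j = out i * adj G i j + out j * adj G j i

    adj≤cover : ∀ i j → adj G i j ≤ cover i j
    adj≤cover i j = 𝟙-≤ (adj? G i j) λ ij → helper ij (adj? G v i) (adj? G v j)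
      where
      helper : Adj G i j → (vi? : Dec (Adj G v i)) (vj? : Dec (Adj G v j)) →
               1 ≤ 𝟙 (colour vi? ≟ 0F) * adj G i j + 𝟙 (colour vj? ≟ 0F) * adj G j i
      helper ij (yes vi) (yes vj) = contradiction ij (no-triangle vi vj)
      helper ij (no _) _ = ≤-trans (≤-reflexive (sym (trans (*-identityˡ _) (𝟙-yes (adj? G i j) ij)))) (m≤m+n _ _)
      helper ij (yes _) (no _) = ≤-reflexive (sym (trans (*-identityˡ _) (𝟙-yes (adj? G j i) (adj-sym G ij))))

    ∑cover : sum₂ cover ≡ 2 * sum (λ i → out i * degree G i)
    ∑cover = begin
      sum₂ cover
        ≡⟨ sum₂-distrib-+ (λ i j → out i * adj G i j) (λ i j → out j * adj G j i) ⟩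
      half + sum₂ (λ i j → out j * adj G j i)
        ≡⟨ cong (half +_) (∑-comm (λ i j → out j * adj G j i)) ⟩
      half + half
        ≡⟨ regroup half ⟩
      2 * half
        ≡⟨ cong (2 *_) (sum-cong-≗ λ i → sym (*-distribˡ-sum (out i) (adj G i))) ⟩
      2 * sum (λ i → out i * degree G i) ∎
      where
      open ≡-Reasoning
      half = sum₂ (λ i j → out i * adj G i j)
      regroup : ∀ h → h + h ≡ 2 * h
      regroup = solve-∀

    out*degree≤ : ∀ i → out i * degree G i ≤ out i * degree G v
    out*degree≤ i = *-monoʳ-≤ (out i) (degree≤ i)

    ∑out*Δ : sum (λ i → out i * degree G v) ≡ p * q
    ∑out*Δ = trans (sum-cong-≗ λ i → *-comm (out i) (degree G v))
      (trans (sym (*-distribˡ-sum (degree G v) out)) (trans (*-comm (degree G v) p) (cong (p *_) degree≡q)))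

    p*q≤quarter : p * q ≤ suc n ^ 2 / 4
    p*q≤quarter = subst (λ s → p * q ≤ s ^ 2 / 4) (classSize₀+classSize₁ side) (product≤quarter p q)

  -- The chain can lose in three places: arcs charged twice, outside vertices whose degree is below
  -- the maximum, and a product pq of unequal sides. In the extremal case each loss is excluded
  -- separately.
  mantel : arcs G ≤ 2 * (suc n ^ 2 / 4)
  mantel = begin
    arcs G                                  ≤⟨ sum₂-mono adj≤cover ⟩
    sum₂ cover                              ≡⟨ ∑cover ⟩
    2 * sum (λ i → out i * degree G i)      ≤⟨ *-monoʳ-≤ 2 (sum-mono out*degree≤) ⟩
    2 * sum (λ i → out i * degree G v)      ≡⟨ cong (2 *_) ∑out*Δ ⟩
    2 * (p * q)                             ≤⟨ *-monoʳ-≤ 2 p*q≤quarter ⟩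
    2 * (suc n ^ 2 / 4)                     ∎
    where open ≤-Reasoning

  module _ (extremal : 2 * (suc n ^ 2 / 4) ≤ arcs G) where

    open ≤-Reasoning

    private
      adj≡cover : ∀ i j → adj G i j ≡ cover i j
      adj≡cover = sum₂-tight adj≤cover (begin
        sum₂ cover                              ≡⟨ ∑cover ⟩
        2 * sum (λ i → out i * degree G i)      ≤⟨ *-monoʳ-≤ 2 (sum-mono out*degree≤) ⟩
        2 * sum (λ i → out i * degree G v)      ≡⟨ cong (2 *_) ∑out*Δ ⟩
        2 * (p * q)                             ≤⟨ *-monoʳ-≤ 2 p*q≤quarter ⟩
        2 * (suc n ^ 2 / 4)                     ≤⟨ extremal ⟩
        arcs G                                  ∎)

      out*degree≡ : ∀ i → out i * degree G i ≡ out i * degree G v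
      out*degree≡ = sum-tight out*degree≤ (*-cancelˡ-≤ 2 (begin
        2 * sum (λ i → out i * degree G v)      ≡⟨ cong (2 *_) ∑out*Δ ⟩
        2 * (p * q)                             ≤⟨ *-monoʳ-≤ 2 p*q≤quarter ⟩
        2 * (suc n ^ 2 / 4)                     ≤⟨ extremal ⟩
        arcs G                                  ≤⟨ sum₂-mono adj≤cover ⟩
        sum₂ cover                              ≡⟨ ∑cover ⟩
        2 * sum (λ i → out i * degree G i)      ∎))

      outside-independent : ∀ {i j} → ¬ Adj G v i → ¬ Adj G v j → ¬ Adj G i j
      outside-independent {i} {j} ¬vi ¬vj ij = contradiction (begin-equality
        1              ≡⟨ 𝟙-yes (adj? G i j) ij ⟨
        adj G i j      ≡⟨ adj≡cover i j ⟩
        cover i j      ≡⟨ cong₂ _+_ (cong₂ _*_ (out-pos ¬vi) (𝟙-yes (adj? G i j) ij))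
                                    (cong₂ _*_ (out-pos ¬vj) (𝟙-yes (adj? G j i) (adj-sym G ij))) ⟩
        2              ∎) (λ ())

      -- As the outside is independent, N(i) is contained in N(v); equal degrees turn the inclusion
      -- into an equality.
      outside-complete : ∀ {i j} → ¬ Adj G v i → Adj G v j → Adj G i j
      outside-complete {i} {j} ¬vi vj = 𝟙-pos (adj? G i j)
        (subst (0 <_) (sym (trans (sum-tight inc (≤-reflexive same) j) (𝟙-yes (adj? G v j) vj))) z<s)
        where
        inc : ∀ j → adj G i j ≤ adj G v j
        inc j = 𝟙-≤ (adj? G i j) λ ij → helper ij (adj? G v j)
          where
          helper : Adj G i j → (vj? : Dec (Adj G v j)) → 1 ≤ 𝟙 vj?
          helper ij (yes _)  = ≤-refl
          helper ij (no ¬vj) = contradiction ij (outside-independent ¬vi ¬vj)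
        same : degree G v ≡ degree G i
        same = begin-equality
          degree G v          ≡⟨ *-identityˡ (degree G v) ⟨
          1 * degree G v      ≡⟨ cong (_* degree G v) (out-pos ¬vi) ⟨
          out i * degree G v  ≡⟨ out*degree≡ i ⟨
          out i * degree G i  ≡⟨ cong (_* degree G i) (out-pos ¬vi) ⟩
          1 * degree G i      ≡⟨ *-identityˡ (degree G i) ⟩
          degree G i          ∎

    mantel-bipartition : IsBipartition G side
    mantel-bipartition i j with adj? G v i | adj? G v j
    ... | yes vi | yes vj = (λ ij → contradiction ij (no-triangle vi vj)) , λ ≢ → contradiction refl ≢
    ... | yes vi | no ¬vj = (λ _ ()) , λ _ → adj-sym G (outside-complete ¬vj vi)
    ... | no ¬vi | yes vj = (λ _ ()) , λ _ → outside-complete ¬vi vj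
    ... | no ¬vi | no ¬vj = (λ ij → contradiction ij (outside-independent ¬vi ¬vj)) , λ ≢ → contradiction refl ≢

    mantel-balanced : suc n ^ 2 / 4 ≤ p * q
    mantel-balanced = *-cancelˡ-≤ 2 (≤-trans extremal (≤-reflexive (bipartition-arcs G side mantel-bipartition)))

-- Edges and triangles in C₅-free graphs

square≤4*quarter+3 : ∀ n → n * n ≤ 4 * (n ^ 2 / 4) + 3
square≤4*quarter+3 n = begin
  n * n                             ≡⟨ cong (n *_) (*-identityʳ n) ⟨
  n ^ 2                             ≡⟨ m≡m%n+[m/n]*n (n ^ 2) 4 ⟩
  n ^ 2 % 4 + n ^ 2 / 4 * 4         ≤⟨ +-monoˡ-≤ (n ^ 2 / 4 * 4) (s≤s⁻¹ (m%n<n (n ^ 2) 4)) ⟩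
  3 + n ^ 2 / 4 * 4                 ≡⟨ +-comm 3 (n ^ 2 / 4 * 4) ⟩
  n ^ 2 / 4 * 4 + 3                 ≡⟨ cong (_+ 3) (*-comm (n ^ 2 / 4) 4) ⟩
  4 * (n ^ 2 / 4) + 3               ∎
  where open ≤-Reasoning

triangle-free-arcs : (G : Graph n) → triangles G ≡ 0 → 2 * arcs G ≤ n * n
triangle-free-arcs {zero}  G _   = z≤n
triangle-free-arcs {suc n} G T≡0 = begin
  2 * arcs G                      ≤⟨ *-monoʳ-≤ 2 (Mantel.mantel G T≡0) ⟩
  2 * (2 * (suc n ^ 2 / 4))       ≡⟨ *-assoc 2 2 (suc n ^ 2 / 4) ⟨
  4 * (suc n ^ 2 / 4)             ≤⟨ 4*quarter≤square (suc n) ⟩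
  suc n * suc n                   ∎
  where open ≤-Reasoning

-- Six times the number of edges and triangles together.
size : Graph n → ℕ
size G = 3 * arcs G + triangles G

size-remove : (G : Graph (suc n)) (v : Fin (suc n)) →
              size G ≡ size (G ∖ v) + 3 * (2 * degree G v + link G v)
size-remove G v = trans (cong₂ (λ a t → 3 * a + t) (arcs-remove G v) (triangles-remove G v))
  (regroup (degree G v) (link G v) (arcs (G ∖ v)) (triangles (G ∖ v)))
  where
  regroup : ∀ d l a t → 3 * (2 * d + a) + (3 * l + t) ≡ 3 * a + t + 3 * (2 * d + l)
  regroup = solve-∀

size≤ : (G : Graph n) → size G ≤ 3 * (n * n) + n * (n * n)
size≤ {n} G = +-mono-≤
  (*-monoʳ-≤ 3 (sum-bound λ i → ≤-trans (sum-bound λ j → 𝟙≤1 (adj? G i j)) (≤-reflexive (*-identityʳ n))))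
  (sum-bound λ i → sum-bound λ j → ≤-trans (sum-bound λ k →
    ≤-trans (≤-reflexive (onTriangle≡𝟙 G i j k)) (𝟙≤1 (triangle? G i j k))) (≤-reflexive (*-identityʳ n)))

free-remove : (F : Graph k) (G : Graph (suc n)) (v : Fin (suc n)) → (F -Free) G → (F -Free) (G ∖ v)
free-remove F G v free F⊑G∖v = free record
  { embed     = punchIn v ∘ embed
  ; injective = injective ∘ punchIn-injective v _ _
  ; preserves = preserves
  }
  where open _⊑_ F⊑G∖v

trivialBound : ℕ → ℕ
trivialBound m = 10 * (3 * (m * m) + m * (m * m)) + m

size≤trivialBound : (G : Graph n) → n ≤ m → 10 * size G + n ≤ trivialBound m
size≤trivialBound G n≤m = +-mono-≤ (*-monoʳ-≤ 10 (≤-trans (size≤ G)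
  (+-mono-≤ (*-monoʳ-≤ 3 (*-mono-≤ n≤m n≤m)) (*-mono-≤ n≤m (*-mono-≤ n≤m n≤m))))) n≤m

-- Abstract, since unification would unfold c₀ ≈ 2 · 10¹² in unary.
abstract

  c₀ : ℕ
  c₀ = trivialBound 5880

  small-size : (G : Graph n) → n ≤ 5880 → 10 * size G + n ≤ c₀
  small-size = size≤trivialBound

-- The factor 10 clears the tenths in the bound for sparse vertices: `10 * size G` is 60(e + t), and
-- 15n² is 60 times n²/4.
triangle-free-size : (G : Graph n) → triangles G ≡ 0 → 10 * size G ≤ 15 * (n * n)
triangle-free-size {n} G T≡0 = begin
  10 * (3 * arcs G + triangles G) ≡⟨ cong (λ t → 10 * (3 * arcs G + t)) T≡0 ⟩
  10 * (3 * arcs G + 0)           ≡⟨ regroup (arcs G) ⟩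
  15 * (2 * arcs G)               ≤⟨ *-monoʳ-≤ 15 (triangle-free-arcs G T≡0) ⟩
  15 * (n * n)                    ∎
  where
  open ≤-Reasoning
  regroup : ∀ a → 10 * (3 * a + 0) ≡ 15 * (2 * a)
  regroup = solve-∀

-- A sparse vertex contributes at most 27 (n + 1) / 10 to the size, while
-- 3 n² / 2 grows by about 3 n.
size-bound : (G : Graph n) → (C 5 -Free) G → 0 < triangles G → 10 * size G + n ≤ 15 * (n * n) + c₀
size-bound {zero} G free ()
size-bound {suc n} G free 0<T with 5880 <? suc n
... | no ≮ = ≤-trans (small-size G (≮⇒≥ ≮)) (m≤n+m c₀ (15 * (suc n * suc n)))
... | yes large with w , sparse ← sparseVertex G free large 0<T = begin
  10 * size G + suc n                     ≡⟨ cong (λ s → 10 * s + suc n) (size-remove G w) ⟩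
  10 * (size (G ∖ w) + 3 * ψ) + suc n     ≤⟨ step (triangles (G ∖ w)) refl ⟩
  15 * (suc n * suc n) + c₀               ∎
  where
  open ≤-Reasoning
  ψ = 2 * degree G w + link G w
  13≤2*n : 13 ≤ 2 * n
  13≤2*n = ≤-trans (m≤m+n 13 (2 * 5880 ∸ 13)) (*-monoʳ-≤ 2 (s≤s⁻¹ large))
  13≤3*n : 13 ≤ 3 * n
  13≤3*n = ≤-trans 13≤2*n (*-monoˡ-≤ n (m≤m+n 2 1))
  inherit : ∀ s ψ n c → 10 * (s + 3 * ψ) + (1 + n) + (15 * (n * n) + c + 3 * (9 * (1 + n)) + 3 * n) + 0 ≡
                        15 * ((1 + n) * (1 + n)) + c + (10 * s + n + 3 * (10 * ψ) + 13)
  inherit = solve-∀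
  fresh : ∀ s ψ n c → 10 * (s + 3 * ψ) + (1 + n) + (15 * (n * n) + 3 * (9 * (1 + n)) + 2 * n) + c ≡
                      15 * ((1 + n) * (1 + n)) + c + (10 * s + 3 * (10 * ψ) + 13)
  fresh = solve-∀
  step : ∀ t → triangles (G ∖ w) ≡ t → 10 * (size (G ∖ w) + 3 * ψ) + suc n ≤ 15 * (suc n * suc n) + c₀
  -- A triangle-free `G ∖ w` passes on no surplus, so this deletion alone must produce n + 1: the
  -- growth 30n + 15 has to cover 27(n + 1) + (n + 1), that is 2n ≥ 13.
  step zero T≡0 = linear-≤ c₀
    (+-mono-≤ (+-mono-≤ (triangle-free-size (G ∖ w) T≡0) (*-monoʳ-≤ 3 sparse)) 13≤2*n)
    (fresh (size (G ∖ w)) ψ n c₀)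
  -- The surplus n is inherited and increases by one: 30n + 15 has to cover 27(n + 1) + 1, that is
  -- 3n ≥ 13.
  step (suc t) T≡ = linear-≤ 0
    (+-mono-≤ (+-mono-≤ (size-bound (G ∖ w) (free-remove (C 5) G w free) (subst (0 <_) (sym T≡) z<s))
      (*-monoʳ-≤ 3 sparse)) 13≤3*n)
    (inherit (size (G ∖ w)) ψ n c₀)

C₅-free-size : (G : Graph n) → (C 5 -Free) G → 10 * size G ≤ 15 * (n * n) + c₀
C₅-free-size {n} G free with triangles G in T≡
... | zero  = ≤-trans (≤-reflexive (cong (λ t → 10 * (3 * arcs G + t)) (sym T≡)))
                (≤-trans (triangle-free-size G T≡) (m≤m+n (15 * (n * n)) c₀))
... | suc _ = ≤-trans (≤-reflexive (cong (λ t → 10 * (3 * arcs G + t)) (sym T≡)))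
                (≤-trans (m≤m+n _ n) (size-bound G free (subst (0 <_) (sym T≡) z<s)))

-- The surplus n pays for `c₀` and for 45 = 15 · 3, the rounding error of the floor.
triangle⇒size< : (G : Graph n) → (C 5 -Free) G → c₀ + 45 < n → 0 < triangles G → size G < 6 * (n ^ 2 / 4)
triangle⇒size< {n} G free large 0<T = *-cancelˡ-< 10 _ _ (linear-≤ 0
  (+-mono-≤ (+-mono-≤ (size-bound G free 0<T) (*-monoʳ-≤ 15 (square≤4*quarter+3 n))) large)
  (regroup (size G) n (n ^ 2 / 4) c₀ (n * n)))
  where
  regroup : ∀ s n q c nn → (1 + 10 * s) + (15 * nn + c + 15 * (4 * q + 3) + n) + 0 ≡
                           10 * (6 * q) + (10 * s + n + 15 * nn + (1 + (c + 45)))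
  regroup = solve-∀

triangle-free-size≤ : (G : Graph n) → triangles G ≡ 0 → size G ≤ 6 * (n ^ 2 / 4)
triangle-free-size≤ {zero}  G T≡0 = z≤n
triangle-free-size≤ {suc n} G T≡0 = begin
  3 * arcs G + triangles G          ≡⟨ trans (cong (3 * arcs G +_) T≡0) (+-identityʳ _) ⟩
  3 * arcs G                        ≤⟨ *-monoʳ-≤ 3 (Mantel.mantel G T≡0) ⟩
  3 * (2 * (suc n ^ 2 / 4))         ≡⟨ *-assoc 3 2 (suc n ^ 2 / 4) ⟨
  6 * (suc n ^ 2 / 4)               ∎
  where open ≤-Reasoning

size≤6*quarter : (G : Graph n) → (C 5 -Free) G → c₀ + 45 < n → size G ≤ 6 * (n ^ 2 / 4)
size≤6*quarter G free large with triangles G in T≡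
... | zero  = ≤-trans (≤-reflexive (cong (3 * arcs G +_) (sym T≡))) (triangle-free-size≤ G T≡)
... | suc _ = ≤-trans (≤-reflexive (cong (3 * arcs G +_) (sym T≡)))
                (<⇒≤ (triangle⇒size< G free large (subst (0 <_) (sym T≡) z<s)))

size-extremal⇒triangle-free : (G : Graph n) → (C 5 -Free) G → c₀ + 45 < n →
                              6 * (n ^ 2 / 4) ≤ size G → triangles G ≡ 0
size-extremal⇒triangle-free G free large ≤size with triangles G in T≡
... | zero  = refl
... | suc _ = contradiction (≤-trans ≤size (≤-reflexive (cong (3 * arcs G +_) (sym T≡))))
                (<⇒≱ (triangle⇒size< G free large (subst (0 <_) (sym T≡) z<s)))

open _⊑_

-- 2C₅-free graphs

Disjoint : {F F′ : Graph k} {G : Graph n} → F ⊑ G → F′ ⊑ G → Set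
Disjoint f g = ∀ i j → embed f i ≢ embed g j

disjoint-copies : {F : Graph k} {G : Graph n} (f g : F ⊑ G) → Disjoint f g → (2 ∙ F) ⊑ G
disjoint-copies {k} {n} {F} {G} f g disj = record
  { embed     = λ u → pick (remQuot {2} k u)
  ; injective = λ {u} {v} eq → trans (sym (combine-remQuot {2} k u))
      (trans (cong (λ (c , i) → combine c i) (pick-injective (remQuot {2} k u) (remQuot {2} k v) eq))
        (combine-remQuot {2} k v))
  ; preserves = λ {u} {v} (c≡c′ , e) → pick-preserves (remQuot {2} k u) (remQuot {2} k v) c≡c′ e
  }
  where
  pick : Fin 2 × Fin k → Fin n
  pick (0F , i) = embed f i
  pick (1F , i) = embed g i
  pick-injective : ∀ x y → pick x ≡ pick y → x ≡ y
  pick-injective (0F , i) (0F , j) eq = cong (0F ,_) (injective f eq)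
  pick-injective (0F , i) (1F , j) eq = contradiction eq (disj i j)
  pick-injective (1F , i) (0F , j) eq = contradiction (sym eq) (disj j i)
  pick-injective (1F , i) (1F , j) eq = cong (1F ,_) (injective g eq)
  pick-preserves : ∀ x y → proj₁ x ≡ proj₁ y → Adj F (proj₂ x) (proj₂ y) → Adj G (pick x) (pick y)
  pick-preserves (0F , i) (0F , j) _ e = preserves f e
  pick-preserves (1F , i) (1F , j) _ e = preserves g e

module Outside {G : Graph n} (S : C 5 ⊑ G) where

  Out : Fin n → Set
  Out j = ∀ i → embed S i ≢ j

  out? : ∀ j → Dec (Out j)
  out? j = all? λ i → ¬? (embed S i ≟ j)

  -- The indicator of the vertex set of S, written as a sum over the cycle so that its total is
  -- found by exchanging sums.
  hit : Fin n → ℕ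
  hit j = sum λ i → 𝟙 (j ≟ embed S i)

  ¬out⇒hit : ∀ {j} → ¬ Out j → 1 ≤ hit j
  ¬out⇒hit {j} ¬out with any? (λ i → j ≟ embed S i)
  ... | yes (i , j≡) = ≤-trans (≤-reflexive (sym (𝟙-yes (j ≟ embed S i) j≡))) (term≤sum (λ i → 𝟙 (j ≟ embed S i)) i)
  ... | no  none = contradiction (λ i eq → none (i , sym eq)) ¬out

  ∑hit≡5 : sum hit ≡ 5
  ∑hit≡5 = trans (∑-comm (λ j i → 𝟙 (j ≟ embed S i))) (trans (sum-cong-≗ λ i → sum-singleton (embed S i)) (sum-const 5 1))

  module _ (R : Graph n) where

    adj-isolate : ∀ i j → adj R i j ≤ adj (R ∣ᴳ out?) i j + (hit i + hit j)
    adj-isolate i j = 𝟙-≤ (adj? R i j) λ ij → helper ij (out? i) (out? j)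
      where
      helper : Adj R i j → Dec (Out i) → Dec (Out j) → 1 ≤ adj (R ∣ᴳ out?) i j + (hit i + hit j)
      helper ij (yes oi) (yes oj) = ≤-trans (≤-reflexive (sym (𝟙-yes (adj? (R ∣ᴳ out?) i j) (ij , oi , oj)))) (m≤m+n _ _)
      helper ij (no ¬oi) _ = ≤-trans (¬out⇒hit ¬oi) (≤-trans (m≤m+n _ _) (m≤n+m _ (adj (R ∣ᴳ out?) i j)))
      helper ij (yes _) (no ¬oj) = ≤-trans (¬out⇒hit ¬oj) (≤-trans (m≤n+m _ (hit i)) (m≤n+m _ (adj (R ∣ᴳ out?) i j)))

    -- Each of the five cycle vertices is the tail of at most n arcs and the head of at most n. The
    -- graph `R` need not contain S: it will be the neighbourhood graph of a vertex.
    arcs-isolate : arcs R ≤ arcs (R ∣ᴳ out?) + 10 * n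
    arcs-isolate = begin
      arcs R
        ≤⟨ sum₂-mono adj-isolate ⟩
      sum₂ (λ i j → adj (R ∣ᴳ out?) i j + (hit i + hit j))
        ≡⟨ sum₂-distrib-+ (adj (R ∣ᴳ out?)) (λ i j → hit i + hit j) ⟩
      arcs (R ∣ᴳ out?) + sum₂ {n} {n} (λ i j → hit i + hit j)
        ≡⟨ cong (arcs (R ∣ᴳ out?) +_) (sum₂-distrib-+ {n} {n} (λ i j → hit i) (λ i j → hit j)) ⟩
      arcs (R ∣ᴳ out?) + (sum₂ {n} {n} (λ i j → hit i) + sum₂ {n} {n} (λ i j → hit j))
        ≡⟨ cong (arcs (R ∣ᴳ out?) +_) (cong₂ _+_ (trans (∑-comm {n} {n} (λ i j → hit i)) rows) rows) ⟩
      arcs (R ∣ᴳ out?) + (n * 5 + n * 5)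
        ≡⟨ cong (arcs (R ∣ᴳ out?) +_) (regroup n) ⟩
      arcs (R ∣ᴳ out?) + 10 * n ∎
      where
      open ≤-Reasoning
      rows : sum₂ {n} {n} (λ i j → hit j) ≡ n * 5
      rows = trans (sum-cong-≗ {n} λ _ → ∑hit≡5) (sum-const n 5)
      regroup : ∀ n → n * 5 + n * 5 ≡ 10 * n
      regroup = solve-∀

  module _ (bound : ℕ) (link≤ : ∀ v → link G v ≤ bound) where

    private
      G′ = G ∣ᴳ out?

      f f′ : Fin n → Fin n → Fin n → ℕ
      f  = onTriangle G
      f′ = onTriangle G′

      split : ∀ i j k → f i j k ≤ f′ i j k + (hit i * f i j k + (hit j * f i j k + hit k * f i j k))
      split i j k = ≤-trans (≤-reflexive (onTriangle≡𝟙 G i j k))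
        (𝟙-≤ (triangle? G i j k) λ t → helper t (out? i) (out? j) (out? k))
        where
        f≡1 : Adj G i j × Adj G i k × Adj G j k → f i j k ≡ 1
        f≡1 t = trans (onTriangle≡𝟙 G i j k) (𝟙-yes (triangle? G i j k) t)
        hit*f : Adj G i j × Adj G i k × Adj G j k → ∀ {l} → ¬ Out l → 1 ≤ hit l * f i j k
        hit*f t {l} ¬o = ≤-trans (¬out⇒hit ¬o) (≤-reflexive (sym (trans (cong (hit l *_) (f≡1 t)) (*-identityʳ (hit l)))))
        helper : Adj G i j × Adj G i k × Adj G j k → Dec (Out i) → Dec (Out j) → Dec (Out k) →
                 1 ≤ f′ i j k + (hit i * f i j k + (hit j * f i j k + hit k * f i j k))
        helper t (no ¬oi) _ _ = ≤-trans (hit*f t ¬oi) (≤-trans (m≤m+n _ _) (m≤n+m _ (f′ i j k)))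
        helper t (yes _) (no ¬oj) _ = ≤-trans (hit*f t ¬oj)
          (≤-trans (m≤m+n _ _) (≤-trans (m≤n+m _ (hit i * f i j k)) (m≤n+m _ (f′ i j k))))
        helper t (yes _) (yes _) (no ¬ok) = ≤-trans (hit*f t ¬ok)
          (≤-trans (m≤n+m _ (hit j * f i j k)) (≤-trans (m≤n+m _ (hit i * f i j k)) (m≤n+m _ (f′ i j k))))
        helper (ij , ik , jk) (yes oi) (yes oj) (yes ok) = ≤-trans (≤-reflexive (sym
          (trans (onTriangle≡𝟙 G′ i j k)
            (𝟙-yes (triangle? G′ i j k) ((ij , oi , oj) , (ik , oi , ok) , (jk , oj , ok)))))) (m≤m+n _ _)

      first : sum (λ i → sum₂ λ j k → hit i * f i j k) ≤ 5 * bound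
      first = begin
        sum (λ i → sum₂ λ j k → hit i * f i j k)
          ≡⟨ sum-cong-≗ (λ i → trans (sum-cong-≗ λ j → sym (*-distribˡ-sum (hit i) (f i j)))
               (sym (*-distribˡ-sum (hit i) (λ j → sum (f i j))))) ⟩
        sum (λ i → hit i * link G i)
          ≤⟨ sum-mono (λ i → ≤-trans (*-monoʳ-≤ (hit i) (link≤ i)) (≤-reflexive (*-comm (hit i) bound))) ⟩
        sum (λ i → bound * hit i)
          ≡⟨ *-distribˡ-sum bound hit ⟨
        bound * sum hit
          ≡⟨ trans (cong (bound *_) ∑hit≡5) (*-comm bound 5) ⟩
        5 * bound ∎
        where open ≤-Reasoning

      second : sum (λ i → sum₂ λ j k → hit j * f i j k) ≡ sum (λ i → sum₂ λ j k → hit i * f i j k)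
      second = trans (∑-comm (λ i j → sum λ k → hit j * f i j k))
        (sum-cong-≗ λ j → sum₂-cong λ i k → cong (hit j *_) (onTriangle-swap₁₂ G i j k))

      third : sum (λ i → sum₂ λ j k → hit k * f i j k) ≡ sum (λ i → sum₂ λ j k → hit j * f i j k)
      third = sum-cong-≗ λ i → trans (∑-comm (λ j k → hit k * f i j k))
        (sum₂-cong λ k j → cong (hit k *_) (onTriangle-swap₂₃ G i j k))

    -- An ordered triangle that disappears has a cycle vertex in one of its three positions, and
    -- each position accounts for at most the links of five vertices.
    triangles-isolate : triangles G ≤ triangles G′ + 15 * bound
    triangles-isolate = begin
      triangles G
        ≤⟨ sum-mono (λ i → sum₂-mono (split i)) ⟩
      sum (λ i → sum₂ λ j k → f′ i j k + (hit i * f i j k + (hit j * f i j k + hit k * f i j k)))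
        ≡⟨ distrib f′ _ ⟩
      triangles G′ + sum (λ i → sum₂ λ j k → hit i * f i j k + (hit j * f i j k + hit k * f i j k))
        ≡⟨ cong (triangles G′ +_) (trans (distrib (λ i j k → hit i * f i j k) _)
             (cong (sum (λ i → sum₂ λ j k → hit i * f i j k) +_)
               (distrib (λ i j k → hit j * f i j k) (λ i j k → hit k * f i j k)))) ⟩
      triangles G′ + (sum (λ i → sum₂ λ j k → hit i * f i j k) + (sum (λ i → sum₂ λ j k → hit j * f i j k) +
        sum (λ i → sum₂ λ j k → hit k * f i j k)))
        ≤⟨ +-monoʳ-≤ (triangles G′) (+-mono-≤ first (+-mono-≤ (≤-trans (≤-reflexive second) first)
             (≤-trans (≤-reflexive (trans third second)) first))) ⟩
      triangles G′ + (5 * bound + (5 * bound + 5 * bound))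
        ≡⟨ cong (triangles G′ +_) (regroup bound) ⟩
      triangles G′ + 15 * bound ∎
      where
      open ≤-Reasoning
      distrib : (g h : Fin n → Fin n → Fin n → ℕ) →
                sum (λ i → sum₂ λ j k → g i j k + h i j k) ≡ sum (λ i → sum₂ (g i)) + sum (λ i → sum₂ (h i))
      distrib g h = trans (sum-cong-≗ λ i → sum₂-distrib-+ (g i) (h i)) (∑-distrib-+ (λ i → sum₂ (g i)) (λ i → sum₂ (h i)))
      regroup : ∀ b → 5 * b + (5 * b + 5 * b) ≡ 15 * b
      regroup = solve-∀

cycleNeighbour : ∀ i → ∃ λ j → Adj (C 5) i j
cycleNeighbour 0F = 1F , (λ ()) , inj₁ refl
cycleNeighbour 1F = 2F , (λ ()) , inj₁ refl
cycleNeighbour 2F = 3F , (λ ()) , inj₁ refl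
cycleNeighbour 3F = 4F , (λ ()) , inj₁ refl
cycleNeighbour 4F = 0F , (λ ()) , inj₁ refl

module 2C₅-Free (G : Graph n) (free : ((2 ∙ C 5) -Free) G) where

  -- The vertices of S survive as isolated ones, but every vertex of a 5-cycle has a neighbour on it
  -- and therefore lies outside S.
  isolate-C₅-free : (S : C 5 ⊑ G) → (C 5 -Free) (G ∣ᴳ Outside.out? S)
  isolate-C₅-free S S′ = free (disjoint-copies S S″ λ i j →
    proj₁ (proj₂ (preserves S′ (proj₂ (cycleNeighbour j)))) i)
    where
    S″ : C 5 ⊑ G
    S″ = record { embed = embed S′ ; injective = injective S′ ; preserves = proj₁ ∘ preserves S′ }

  module _ (v : Fin n) (large : 14 * n < link G v) where

    -- At most 10 n arcs touch S, and more than 4 n others contain a P₄, which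
    -- forms a 5-cycle with v.
    ¬avoids : (S : C 5 ⊑ G) → ¬ (∀ i → embed S i ≢ v)
    ¬avoids S avoid = <⇒≱ large (begin
      link G v             ≡⟨ link≡arcs G v ⟩
      arcs (G ∣ᴳ adj? G v) ≤⟨ arcs-isolate (G ∣ᴳ adj? G v) ⟩
      arcs B + 10 * n      ≤⟨ +-monoˡ-≤ (10 * n) (P₄-Free⇒arcs≤ B B-P₄-free (λ _ → 1) (λ _ → ≤-refl)) ⟩
      4 * sum {n} (λ _ → 1) + 10 * n ≡⟨ cong (λ s → 4 * s + 10 * n) (trans (sum-const n 1) (*-identityʳ n)) ⟩
      4 * n + 10 * n       ≡⟨ *-distribʳ-+ n 4 10 ⟨
      14 * n               ∎)
      where
      open ≤-Reasoning
      open Outside S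
      B = (G ∣ᴳ adj? G v) ∣ᴳ out?
      B-P₄-free : P₄-Free B
      B-P₄-free ((pj , vp , vj) , op , oj) ((jk , _ , vk) , _ , ok) ((kq , _ , vq) , _ , oq) p≢k p≢q j≢q =
        free (disjoint-copies S (pentagon G vp pj jk kq (adj-sym G vq) (adj≢ G vj) (adj≢ G vk) p≢k p≢q j≢q)
          λ i → λ { 0F → avoid i ; 1F → op i ; 2F → oj i ; 3F → ok i ; 4F → oq i })

  module _ (small : ∀ v → link G v ≤ 14 * n) where

    -- Eliminates the arcs A between T ≤ 4A, taken 30 times, and 10(3A + T) ≤ 15n² + `c₀`, taken 4
    -- times.
    70*triangles≤ : (H : Graph n) → (C 5 -Free) H → 70 * triangles H ≤ 60 * (n * n) + 4 * c₀
    70*triangles≤ H H-free = linear-≤ 0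
      (+-mono-≤ (*-monoʳ-≤ 30 (C₅-Free.triangles≤4*arcs H H-free)) (*-monoʳ-≤ 4 (C₅-free-size H H-free)))
      (regroup (arcs H) (triangles H) (n * n) c₀)
      where
      regroup : ∀ a t nn c → 70 * t + (30 * (4 * a) + 4 * (15 * nn + c)) + 0 ≡
                             60 * nn + 4 * c + (30 * t + 4 * (10 * (3 * a + t)))
      regroup = solve-∀

    -- Whether G contains a 5-cycle is not decided. If the bound failed, every 5-cycle S would be
    -- contradictory, since isolating it gives the bound; then G would be C₅-free and the bound
    -- would follow anyway.
    few-triangles : 70 * triangles G ≤ 60 * (n * n) + 4 * c₀ + 70 * (15 * (14 * n))
    few-triangles = decidable-stable (70 * triangles G ≤? _) λ many →
      many (≤-trans (70*triangles≤ G λ S → many (begin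
        70 * triangles G
          ≤⟨ *-monoʳ-≤ 70 (Outside.triangles-isolate S (14 * n) small) ⟩
        70 * (triangles (G ∣ᴳ Outside.out? S) + 15 * (14 * n))
          ≡⟨ *-distribˡ-+ 70 (triangles (G ∣ᴳ Outside.out? S)) (15 * (14 * n)) ⟩
        70 * triangles (G ∣ᴳ Outside.out? S) + 70 * (15 * (14 * n))
          ≤⟨ +-monoˡ-≤ (70 * (15 * (14 * n))) (70*triangles≤ (G ∣ᴳ Outside.out? S) (isolate-C₅-free S)) ⟩
        60 * (n * n) + 4 * c₀ + 70 * (15 * (14 * n)) ∎)) (m≤m+n _ _))
      where open ≤-Reasoning

open _≅_

-- The cone over the Turán graph

-- Vertex `zero` is sent to any j of its own class; removing both keeps the class sizes equal.
matchClasses : (c t : Fin n → Fin r) → (∀ a → classSize c a ≡ classSize t a) →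
               ∃ λ (π : Permutation′ n) → ∀ i → t (π ⟨$⟩ʳ i) ≡ c i
matchClasses {zero} c t _ = Perm.id , λ ()
matchClasses {suc n} c t sizes
  with j , 0<tj ← sum-pos (λ j → 𝟙 (t j ≟ c zero)) (≤-trans
         (≤-trans (≤-reflexive (sym (𝟙-yes (c zero ≟ c zero) refl))) (m≤m+n _ _))
         (≤-reflexive (sizes (c zero))))
  with tj≡c0 ← 𝟙-pos (t j ≟ c zero) 0<tj
  with π , tπ≡c ← matchClasses (c ∘ suc) (t ∘ punchIn j) (λ a → +-cancelˡ-≡ (𝟙 (c zero ≟ a)) _ _
         (trans (sizes a) (trans (sum-remove {i = j} (λ i → 𝟙 (t i ≟ a)))
           (cong (λ b → 𝟙 (b ≟ a) + classSize (t ∘ punchIn j) a) tj≡c0)))) =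
  insert zero j π , λ
    { zero    → tj≡c0
    ; (suc i) → trans (cong t (insert-punchIn zero j π i)) (tπ≡c i)
    }

matchBipartition : (c t : Fin n → Fin 2) → classSize c 0F ≡ classSize t 0F →
                   ∃ λ (π : Permutation′ n) → ∀ i → t (π ⟨$⟩ʳ i) ≡ c i
matchBipartition c t size₀ = matchClasses c t λ
  { 0F → size₀
  ; 1F → +-cancelˡ-≡ (classSize c 0F) _ _ (trans (classSize₀+classSize₁ c)
      (trans (sym (classSize₀+classSize₁ t)) (cong (_+ classSize t 1F) (sym size₀))))
  }

flip : Fin 2 → Fin 2
flip 0F = 1F
flip 1F = 0F

flip-injective : ∀ {a b} → flip a ≡ flip b → a ≡ b
flip-injective {0F} {0F} _ = refl
flip-injective {0F} {1F} ()
flip-injective {1F} {0F} ()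
flip-injective {1F} {1F} _ = refl

classSize-flip : (c : Fin n → Fin 2) → classSize (flip ∘ c) 0F ≡ classSize c 1F
classSize-flip c = sum-cong-≗ λ i → eq (c i)
  where
  eq : ∀ a → 𝟙 (flip a ≟ 0F) ≡ 𝟙 (a ≟ 1F)
  eq 0F = refl
  eq 1F = refl

half-unique : ∀ {p q p′ q′} → q ≤ suc p → p′ ≤ q′ → p + q ≡ p′ + q′ → p′ ≤ p
half-unique {p} {q} {p′} {q′} q≤1+p p′≤q′ eq with p′ ≤? p
... | yes p′≤p = p′≤p
... | no  p′≰p = contradiction (begin
  suc (p + suc p)  ≡⟨⟩
  suc p + suc p    ≤⟨ +-mono-≤ (≰⇒> p′≰p) (≤-trans (≰⇒> p′≰p) p′≤q′) ⟩
  p′ + q′          ≡⟨ eq ⟨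
  p + q            ≤⟨ +-monoʳ-≤ p q≤1+p ⟩
  p + suc p        ∎) (<-irrefl refl)
  where open ≤-Reasoning

ordered-unique : ∀ {p q p′ q′} → p ≤ q → q ≤ suc p → p′ ≤ q′ → q′ ≤ suc p′ → p + q ≡ p′ + q′ → p ≡ p′
ordered-unique p≤q q≤ p′≤q′ q′≤ eq = ≤-antisym (half-unique q′≤ p≤q (sym eq)) (half-unique q≤ p′≤q′ eq)

-- Two even splittings of the same total agree only as unordered pairs, since either colour may have
-- the larger class. The second alternative is what `flip` is for.
balanced-unique : ∀ p q p′ q′ → p ≤ suc q → q ≤ suc p → p′ ≤ suc q′ → q′ ≤ suc p′ → p + q ≡ p′ + q′ →
                  p ≡ p′ ⊎ q ≡ p′
balanced-unique p q p′ q′ p≤ q≤ p′≤ q′≤ eq with ≤-total p q | ≤-total p′ q′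
... | inj₁ p≤q | inj₁ p′≤q′ = inj₁ (ordered-unique p≤q q≤ p′≤q′ q′≤ eq)
... | inj₂ q≤p | inj₁ p′≤q′ = inj₂ (ordered-unique q≤p p≤ p′≤q′ q′≤ (trans (+-comm q p) eq))
... | inj₁ p≤q | inj₂ q′≤p′ with ordered-unique p≤q q≤ q′≤p′ p′≤ (trans eq (+-comm p′ q′))
...   | refl = inj₂ (+-cancelˡ-≡ p q p′ (trans eq (+-comm p′ p)))
balanced-unique p q p′ q′ p≤ q≤ p′≤ q′≤ eq | inj₂ q≤p | inj₂ q′≤p′
  with ordered-unique q≤p p≤ q′≤p′ p′≤ (trans (+-comm q p) (trans eq (+-comm p′ q′)))
... | refl = inj₁ (+-cancelʳ-≡ q p p′ eq)

copy : {F : Graph k} {G : Graph n} → (2 ∙ F) ⊑ G → Fin 2 → F ⊑ G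
copy {F = F} S c = record
  { embed     = embed S ∘ combine c
  ; injective = λ {i} {j} eq → combine-injectiveʳ c i c j (injective S eq)
  ; preserves = λ {i} {j} ij → preserves S (subst₂ (λ x y → proj₁ x ≡ proj₁ y × Adj F (proj₂ x) (proj₂ y))
      (sym (remQuot-combine c i)) (sym (remQuot-combine c j)) (refl , ij))
  }

module _ (m : ℕ) where

  private
    part : Fin m → Fin 2
    part = turánPart 2 m

    part-balanced : ∀ a b → classSize part a ≤ suc (classSize part b)
    part-balanced a b = ≤-trans (≤-reflexive (sym (partSize≡classSize part a)))
      (≤-trans (turán-balanced 2 m a b) (s≤s (≤-reflexive (partSize≡classSize part b))))

  turán-bipartition : IsBipartition (T 2 m) part
  turán-bipartition i j = (λ e → e) , (λ e → e)

  turán-arcs : arcs (T 2 m) ≡ 2 * (m ^ 2 / 4)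
  turán-arcs = trans (bipartition-arcs (T 2 m) part turán-bipartition)
    (cong (2 *_) (trans (balanced⇒product≡quarter _ _ (part-balanced 0F 1F) (part-balanced 1F 0F))
      (cong (λ s → s ^ 2 / 4) (classSize₀+classSize₁ part))))

  matchTurán : (c : Fin m → Fin 2) → classSize c 0F ≤ suc (classSize c 1F) → classSize c 1F ≤ suc (classSize c 0F) →
               ∃ λ (π : Permutation′ m) → ∀ i j → (c i ≢ c j → part (π ⟨$⟩ʳ i) ≢ part (π ⟨$⟩ʳ j)) ×
                                                  (part (π ⟨$⟩ʳ i) ≢ part (π ⟨$⟩ʳ j) → c i ≢ c j)
  matchTurán c c₀≤ c₁≤ with balanced-unique (classSize c 0F) (classSize c 1F) (classSize part 0F) (classSize part 1F)
      c₀≤ c₁≤ (part-balanced 0F 1F) (part-balanced 1F 0F)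
      (trans (classSize₀+classSize₁ c) (sym (classSize₀+classSize₁ part)))
  ... | inj₁ p≡ with π , eq ← matchBipartition c part p≡ = π , λ i j →
    (λ c≢ p≡p → c≢ (trans (sym (eq i)) (trans p≡p (eq j)))) ,
    (λ p≢ c≡c → p≢ (trans (eq i) (trans c≡c (sym (eq j)))))
  ... | inj₂ q≡ with π , eq ← matchBipartition (flip ∘ c) part (trans (classSize-flip c) q≡) = π , λ i j →
    (λ c≢ p≡p → c≢ (flip-injective (trans (sym (eq i)) (trans p≡p (eq j))))) ,
    (λ p≢ c≡c → p≢ (trans (eq i) (trans (cong flip c≡c) (sym (eq j)))))

  cone : Graph (suc m)
  cone = K 1 +ᴳ T 2 m

  turán-triangle-free : triangles (T 2 m) ≡ 0
  turán-triangle-free with triangles (T 2 m) in eq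
  ... | zero  = refl
  ... | suc _ with x , y , z , xy , xz , yz ← triangle (T 2 m) (subst (0 <_) (sym eq) z<s) =
    contradiction yz (three xy xz)
    where
    three : ∀ {a b c : Fin 2} → a ≢ b → a ≢ c → ¬ (b ≢ c)
    three {0F} {0F} a≢b _ _ = a≢b refl
    three {0F} {1F} {0F} _ a≢c _ = a≢c refl
    three {0F} {1F} {1F} _ _ b≢c = b≢c refl
    three {1F} {1F} a≢b _ _ = a≢b refl
    three {1F} {0F} {1F} _ a≢c _ = a≢c refl
    three {1F} {0F} {0F} _ _ b≢c = b≢c refl

  apex-link : link cone zero ≡ arcs (T 2 m)
  apex-link = trans (link-remove cone zero) (sum₂-cong {m} {m} {λ j k → 1 * (1 * adj (T 2 m) j k)} {adj (T 2 m)}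
    λ j k → trans (*-identityˡ (1 * adj (T 2 m) j k)) (*-identityˡ (adj (T 2 m) j k)))

  cone-triangles : triangles cone ≡ 6 * (m ^ 2 / 4)
  cone-triangles = begin
    triangles cone                               ≡⟨ triangles-remove cone zero ⟩
    3 * link cone zero + triangles (T 2 m)       ≡⟨ cong₂ (λ l t → 3 * l + t) apex-link turán-triangle-free ⟩
    3 * arcs (T 2 m) + 0                         ≡⟨ trans (+-identityʳ _) (cong (3 *_) turán-arcs) ⟩
    3 * (2 * (m ^ 2 / 4))                        ≡⟨ *-assoc 3 2 (m ^ 2 / 4) ⟨
    6 * (m ^ 2 / 4)                              ∎
    where open ≡-Reasoning

  -- An odd cycle does not fit into a bipartite graph.
  pentagon-meets-apex : (S : C 5 ⊑ cone) → ∃ λ i → embed S i ≡ zero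
  pentagon-meets-apex S with any? (λ i → embed S i ≟ zero)
  ... | yes found = found
  ... | no  none  = ⊥-elim (5-cycle (side 0F 1F ((λ ()) , inj₁ refl)) (side 1F 2F ((λ ()) , inj₁ refl))
      (side 2F 3F ((λ ()) , inj₁ refl)) (side 3F 4F ((λ ()) , inj₁ refl))
      (side 4F 0F ((λ ()) , inj₁ refl)))
    where
    class : Fin (suc m) → Fin 2
    -- An arbitrary value: no vertex of `S` is mapped to the apex in this case.
    class zero    = 0F
    class (suc i) = part i
    side : ∀ i j → Adj (C 5) i j → class (embed S i) ≢ class (embed S j)
    side i j ij with embed S i in eqi | embed S j in eqj | preserves S ij
    ... | zero  | _     | _ = contradiction (i , eqi) none
    ... | suc _ | zero  | _ = contradiction (j , eqj) none
    ... | suc _ | suc _ | e = e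
    opposite : ∀ {a b} → a ≢ b → b ≡ flip a
    opposite {0F} {0F} a≢a = contradiction refl a≢a
    opposite {0F} {1F} _ = refl
    opposite {1F} {0F} _ = refl
    opposite {1F} {1F} a≢a = contradiction refl a≢a
    flip-flip : ∀ a → flip (flip a) ≡ a
    flip-flip 0F = refl
    flip-flip 1F = refl
    two : ∀ {a b c} → a ≢ b → b ≢ c → c ≡ a
    two a≢b b≢c = trans (opposite b≢c) (trans (cong flip (opposite a≢b)) (flip-flip _))
    5-cycle : ∀ {a b c d e} → a ≢ b → b ≢ c → c ≢ d → d ≢ e → e ≢ a → ⊥
    5-cycle ab bc cd de ea = contradiction (trans (two cd de) (two ab bc)) ea

  -- Each of the two disjoint 5-cycles would have to use the one apex.
  cone-free : ((2 ∙ C 5) -Free) cone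
  cone-free S with i , fi≡0 ← pentagon-meets-apex (copy S 0F) | j , gj≡0 ← pentagon-meets-apex (copy S 1F) =
    contradiction (combine-injectiveˡ {2} {5} 0F i 1F j (injective S (trans fi≡0 (sym gj≡0)))) λ ()

  ≅⇒free : (G : Graph n) → G ≅ cone → ((2 ∙ C 5) -Free) G
  ≅⇒free G G≅ S = cone-free record
    { embed     = Inverse.to (bijection G≅) ∘ embed S
    ; injective = injective S ∘ to-injective
    ; preserves = Equivalence.to (adj⇔adj G≅ _ _) ∘ preserves S
    }
    where
    to-injective : ∀ {i j} → bijection G≅ ⟨$⟩ʳ i ≡ bijection G≅ ⟨$⟩ʳ j → i ≡ j
    to-injective eq = trans (sym (Perm.inverseˡ (bijection G≅)))
      (trans (cong (bijection G≅ Perm.⟨$⟩ˡ_) eq) (Perm.inverseˡ (bijection G≅)))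

≅⇒triangles : (G : Graph m) (H : Graph n) → G ≅ H → triangles G ≡ triangles H
≅⇒triangles {m} {n} G H G≅H = sym (begin
  sum (λ i → sum₂ (f i))
    ≡⟨ sum-permute (λ i → sum₂ (f i)) π ⟩
  sum (λ i → sum₂ (f (π ⟨$⟩ʳ i)))
    ≡⟨ sum-cong-≗ (λ i → trans (sum-permute (λ j → sum (f (π ⟨$⟩ʳ i) j)) π)
         (sum-cong-≗ λ j → sum-permute (f (π ⟨$⟩ʳ i) (π ⟨$⟩ʳ j)) π)) ⟩
  sum (λ i → sum₂ λ j k → f (π ⟨$⟩ʳ i) (π ⟨$⟩ʳ j) (π ⟨$⟩ʳ k))
    ≡⟨ sum-cong-≗ (λ i → sum₂-cong λ j k → cong₂ _*_ (same i j) (cong₂ _*_ (same i k) (same j k))) ⟩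
  triangles G ∎)
  where
  open ≡-Reasoning
  π = bijection G≅H
  f = onTriangle H
  same : ∀ i j → adj H (π ⟨$⟩ʳ i) (π ⟨$⟩ʳ j) ≡ adj G i j
  same i j = 𝟙-cong (adj? H _ _) (adj? G i j) (Equivalence.from (adj⇔adj G≅H i j)) (Equivalence.to (adj⇔adj G≅H i j))

-- Extremal graphs

insert-at : ∀ i j (π : Permutation′ n) → insert i j π ⟨$⟩ʳ i ≡ j
insert-at i j π with i ≟ i
... | yes _   = refl
... | no  i≢i = contradiction refl i≢i

punchIn-view : (v i : Fin (suc n)) → v ≡ i ⊎ ∃ λ j → punchIn v j ≡ i
punchIn-view v i with v ≟ i
... | yes v≡i = inj₁ v≡i
... | no  v≢i = inj₂ (punchOut v≢i , punchIn-punchOut v≢i)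

cone-iso : (G : Graph (suc m)) (v : Fin (suc m)) (c : Fin m → Fin 2) → IsBipartition (G ∖ v) c →
           classSize c 0F ≤ suc (classSize c 1F) → classSize c 1F ≤ suc (classSize c 0F) →
           (∀ j → Adj G v (punchIn v j)) → G ≅ cone m
cone-iso {m} G v c bip c₀≤ c₁≤ universal with π , π-iso ← matchTurán m c c₀≤ c₁≤ = record
  { bijection = insert v zero π
  ; adj⇔adj   = λ i j → iso (punchIn-view v i) (punchIn-view v j)
  }
  where
  iso : ∀ {i j} → v ≡ i ⊎ ∃ (λ i′ → punchIn v i′ ≡ i) → v ≡ j ⊎ ∃ (λ j′ → punchIn v j′ ≡ j) →
        Adj G i j ⇔ Adj (cone m) (insert v zero π ⟨$⟩ʳ i) (insert v zero π ⟨$⟩ʳ j)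
  iso (inj₁ refl) (inj₁ refl) = subst₂ (λ x y → Adj G v v ⇔ Adj (cone m) x y)
    (sym (insert-at v zero π)) (sym (insert-at v zero π))
    (mk⇔ (λ vv → contradiction vv (loopless G)) (λ 0≢0 → contradiction refl 0≢0))
  iso (inj₁ refl) (inj₂ (j , refl)) = subst₂ (λ x y → Adj G v (punchIn v j) ⇔ Adj (cone m) x y)
    (sym (insert-at v zero π)) (sym (insert-punchIn v zero π j))
    (mk⇔ (λ _ → tt) (λ _ → universal j))
  iso (inj₂ (i , refl)) (inj₁ refl) = subst₂ (λ x y → Adj G (punchIn v i) v ⇔ Adj (cone m) x y)
    (sym (insert-punchIn v zero π i)) (sym (insert-at v zero π))
    (mk⇔ (λ _ → tt) (λ _ → adj-sym G (universal i)))
  iso (inj₂ (i , refl)) (inj₂ (j , refl)) = subst₂ (λ x y → Adj G (punchIn v i) (punchIn v j) ⇔ Adj (cone m) x y)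
    (sym (insert-punchIn v zero π i)) (sym (insert-punchIn v zero π j))
    (mk⇔ (proj₁ (π-iso i j) ∘ proj₁ (bip i j)) (proj₂ (bip i j) ∘ proj₂ (π-iso i j)))

balanced-nonempty : ∀ {p q} → p ≤ suc q → 2 ≤ p + q → 0 < q
balanced-nonempty {p} {zero} p≤1 2≤p+0 = contradiction
  (≤-trans 2≤p+0 (≤-trans (≤-reflexive (+-identityʳ p)) p≤1))
  λ { (s≤s ()) }
balanced-nonempty {q = suc _} _ _ = z<s

bipartition-neighbour : (H : Graph n) (c : Fin n → Fin 2) → IsBipartition H c →
                        0 < classSize c 0F → 0 < classSize c 1F → ∀ i → ∃ λ j → Adj H i j
bipartition-neighbour H c bip 0<p 0<q i
  with a , ca>0 ← sum-pos (λ i → 𝟙 (c i ≟ 0F)) 0<p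
  with b , cb>0 ← sum-pos (λ i → 𝟙 (c i ≟ 1F)) 0<q
  with ca ← 𝟙-pos (c a ≟ 0F) ca>0
  with cb ← 𝟙-pos (c b ≟ 1F) cb>0
  with c i in ci
... | 0F = b , proj₂ (bip i b) λ eq → contradiction (trans (sym ci) (trans eq cb)) λ ()
... | 1F = a , proj₂ (bip i a) λ eq → contradiction (trans (sym ci) (trans eq ca)) λ ()

module Extremal (large : c₀ + 400 ≤ m) (G : Graph (suc m)) (free : ((2 ∙ C 5) -Free) G) where

  open 2C₅-Free G free

  private
    q = m ^ 2 / 4

    400≤m : 400 ≤ m
    400≤m = ≤-trans (m≤n+m 400 c₀) large

    c₀+45<m : c₀ + 45 < m
    c₀+45<m = ≤-trans (≤-reflexive (sym (+-suc c₀ 45))) (≤-trans (+-monoʳ-≤ c₀ (m≤m+n 46 354)) large)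

  -- After scaling by 70, n²/7 against n²/4 becomes 60m² against 105m². For m ≥ 400 the difference
  -- 45m² is at least 18000m, which absorbs the linear terms: 14700m = 70 · 15 · 14m from isolating
  -- a 5-cycle and 120m from (m + 1)². What remains covers 4`c₀` and the constants.
  small-links⇒few : (∀ v → link G v ≤ 14 * suc m) → triangles G < 6 * q
  small-links⇒few small = *-cancelˡ-< 70 _ _ (linear-≤ (3136 * m + 2524)
    (+-mono-≤ (+-mono-≤ (+-mono-≤ (+-mono-≤ (few-triangles small) (*-monoʳ-≤ 105 (square≤4*quarter+3 m)))
      (*-monoʳ-≤ 45 (*-monoʳ-≤ m 400≤m))) (*-monoʳ-≤ 4 large)) (*-monoʳ-≤ 40 400≤m))
    (regroup (triangles G) m c₀ q))
    where
    regroup : ∀ t m c q →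
      (1 + 70 * t) + (60 * ((1 + m) * (1 + m)) + 4 * c + 70 * (15 * (14 * (1 + m))) + 105 * (4 * q + 3) +
        45 * (m * m) + 4 * m + 40 * m) + (3136 * m + 2524)
      ≡ 70 * (6 * q) + (70 * t + 105 * (m * m) + 45 * (m * 400) + 4 * (c + 400) + 16000)
    regroup = solve-∀

  module LargeLink (v : Fin (suc m)) (heavy : 14 * suc m < link G v) where

    private
      H = G ∖ v

      H-free : (C 5 -Free) H
      H-free S = ¬avoids v heavy S′ λ i → punchInᵢ≢i v (embed S i)
        where
        S′ : C 5 ⊑ G
        S′ = record
          { embed     = punchIn v ∘ embed S
          ; injective = injective S ∘ punchIn-injective v _ _
          ; preserves = preserves S
          }

      linkAdj : Fin m → Fin m → ℕ
      linkAdj j k = onTriangle G v (punchIn v j) (punchIn v k)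

      linkAdj≤adj : ∀ j k → linkAdj j k ≤ adj H j k
      linkAdj≤adj j k = ≤-trans
        (*-mono-≤ (𝟙≤1 (adj? G v (punchIn v j))) (*-monoˡ-≤ (adj H j k) (𝟙≤1 (adj? G v (punchIn v k)))))
        (≤-reflexive (trans (*-identityˡ _) (*-identityˡ (adj H j k))))

      link≤arcs : link G v ≤ arcs H
      link≤arcs = ≤-trans (≤-reflexive (link-remove G v)) (sum₂-mono linkAdj≤adj)

    triangles≤size : triangles G ≤ size H
    triangles≤size = ≤-trans (≤-reflexive (triangles-remove G v)) (+-monoˡ-≤ (triangles H) (*-monoʳ-≤ 3 link≤arcs))

    triangles≤ : triangles G ≤ 6 * q
    triangles≤ = ≤-trans triangles≤size (size≤6*quarter H H-free c₀+45<m)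

    module _ (extremal : 6 * q ≤ triangles G) where

      private
        H-triangle-free : triangles H ≡ 0
        H-triangle-free = size-extremal⇒triangle-free H H-free c₀+45<m (≤-trans extremal triangles≤size)

        2*q≤link : 2 * q ≤ link G v
        2*q≤link = *-cancelˡ-≤ 3 (begin
          3 * (2 * q)                ≡⟨ *-assoc 3 2 q ⟨
          6 * q                      ≤⟨ extremal ⟩
          triangles G                ≡⟨ triangles-remove G v ⟩
          3 * link G v + triangles H ≡⟨ trans (cong (3 * link G v +_) H-triangle-free) (+-identityʳ _) ⟩
          3 * link G v               ∎)
          where open ≤-Reasoning

      -- Equality forces `link G v` to equal `arcs H`, so every edge of H lies in N(v). By the
      -- equality case of Mantel's theorem H is complete bipartite with two nonempty classes; each
      -- of its vertices therefore lies on an edge, and v is adjacent to all of them.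
      iso : G ≅ cone m
      iso = helper m G v H-triangle-free (≤-trans 2*q≤link link≤arcs)
        (sum₂-tight linkAdj≤adj (begin
          arcs H         ≤⟨ *-cancelˡ-≤ 3 (begin
            3 * arcs H               ≤⟨ m≤m+n (3 * arcs H) (triangles H) ⟩
            size H                   ≤⟨ size≤6*quarter H H-free c₀+45<m ⟩
            6 * q                    ≡⟨ *-assoc 3 2 q ⟩
            3 * (2 * q)              ≤⟨ *-monoʳ-≤ 3 2*q≤link ⟩
            3 * link G v             ∎) ⟩
          link G v       ≡⟨ link-remove G v ⟩
          sum₂ linkAdj   ∎))
        (≤-trans (m≤m+n 2 398) 400≤m)
        where
        open ≤-Reasoning
        -- The number m is fixed by the enclosing module; it is generalised here to be matched
        -- against `suc`, as `Mantel` is stated for nonempty vertex sets.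
        helper : ∀ m (G : Graph (suc m)) v → triangles (G ∖ v) ≡ 0 → 2 * (m ^ 2 / 4) ≤ arcs (G ∖ v) →
                 (∀ j k → onTriangle G v (punchIn v j) (punchIn v k) ≡ adj (G ∖ v) j k) →
                 2 ≤ m → G ≅ cone m
        helper (suc m) G v T≡0 ≤arcs tight 2≤m =
          cone-iso G v side (mantel-bipartition ≤arcs) (proj₁ balanced) (proj₂ balanced) λ j →
          let k , jk = bipartition-neighbour (G ∖ v) side (mantel-bipartition ≤arcs)
                (balanced-nonempty (proj₂ balanced) (≤-trans 2≤m (≤-reflexive
                  (trans (sym (classSize₀+classSize₁ side)) (+-comm (classSize side 0F) _)))))
                (balanced-nonempty (proj₁ balanced) (≤-trans 2≤m (≤-reflexive (sym (classSize₀+classSize₁ side))))) j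
          in proj₁ (𝟙-pos (triangle? G v (punchIn v j) (punchIn v k))
               (subst (0 <_) (sym (trans (sym (onTriangle≡𝟙 G v (punchIn v j) (punchIn v k)))
                 (trans (tight j k) (𝟙-yes (adj? (G ∖ v) j k) jk)))) z<s))
          where
          open Mantel (G ∖ v) T≡0 using (side; mantel-bipartition; mantel-balanced)
          balanced = quarter≤product⇒balanced (classSize side 0F) (classSize side 1F)
            (≤-trans (≤-reflexive (cong (λ s → s ^ 2 / 4) (classSize₀+classSize₁ side))) (mantel-balanced ≤arcs))

  heavy? : Dec (∃ λ v → 14 * suc m < link G v)
  heavy? = any? λ v → 14 * suc m <? link G v

  triangles≤ : triangles G ≤ 6 * q
  triangles≤ with heavy?
  ... | yes (v , heavy) = LargeLink.triangles≤ v heavy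
  ... | no  none        = <⇒≤ (small-links⇒few λ v → ≮⇒≥ λ heavy → none (v , heavy))

  extremal⇒≅ : 6 * q ≤ triangles G → G ≅ cone m
  extremal⇒≅ extremal with heavy?
  ... | yes (v , heavy) = LargeLink.iso v heavy extremal
  ... | no  none        = contradiction extremal (<⇒≱ (small-links⇒few λ v → ≮⇒≥ λ heavy → none (v , heavy)))

  #K₃≤ : #K 3 G ≤ q
  #K₃≤ = *-cancelˡ-≤ 6 (≤-trans (≤-reflexive (6*#K₃≡triangles G)) triangles≤)

theorem4 : ∃ λ (n₀ : ℕ) → ∀ (n : ℕ) → n₀ ≤ n →
    IsEx n 3 (2 ∙ C 5) ((n ∸ 1) ^ 2 / 4) ×
    (∀ (G : Graph n) → IsExtremal 3 (2 ∙ C 5) G ⇔ G ≅ K 1 +ᴳ T 2 (n ∸ 1))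
-- The extra one is for the apex: the estimates ask for m = n - 1 ≥ `c₀` + 400.
theorem4 = suc (c₀ + 400) , λ
  { (suc m) (s≤s large) → isEx m large , λ G → mk⇔ (to m large G) (from m large G) }
  where
  #K₃-≅ : ∀ m (G : Graph (suc m)) → G ≅ cone m → #K 3 G ≡ m ^ 2 / 4
  #K₃-≅ m G G≅ = *-cancelˡ-≡ _ _ 6 (trans (6*#K₃≡triangles G) (trans (≅⇒triangles G (cone m) G≅) (cone-triangles m)))

  #K₃-cone : ∀ m → #K 3 (cone m) ≡ m ^ 2 / 4
  #K₃-cone m = *-cancelˡ-≡ _ _ 6 (trans (6*#K₃≡triangles (cone m)) (cone-triangles m))

  isEx : ∀ m → c₀ + 400 ≤ m → IsEx (suc m) 3 (2 ∙ C 5) (m ^ 2 / 4)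
  isEx m large = (cone m , cone-free m , #K₃-cone m) , Extremal.#K₃≤ large

  to : ∀ m → c₀ + 400 ≤ m → (G : Graph (suc m)) → IsExtremal 3 (2 ∙ C 5) G → G ≅ cone m
  to m large G (free , _ , maximal) = Extremal.extremal⇒≅ large G free (begin
    6 * (m ^ 2 / 4)       ≡⟨ cong (6 *_) (#K₃-cone m) ⟨
    6 * #K 3 (cone m)     ≤⟨ *-monoʳ-≤ 6 (maximal (cone m) (cone-free m)) ⟩
    6 * #K 3 G            ≡⟨ 6*#K₃≡triangles G ⟩
    triangles G           ∎)
    where open ≤-Reasoning

  from : ∀ m → c₀ + 400 ≤ m → (G : Graph (suc m)) → G ≅ cone m → IsExtremal 3 (2 ∙ C 5) G
  from m large G G≅ = ≅⇒free m G G≅ , subst (IsEx (suc m) 3 (2 ∙ C 5)) (sym (#K₃-≅ m G G≅)) (isEx m large)
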